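{- Let $v$ be a vertex that has all iterated bases defined, and let $p$ be an $\mathrm{evenlevel}(v)$ path or an $\mathrm{oddlevel}(v)$ path. Then for each vertex $u$ on $p$, all iterated bases of $u$ lie on $p$.
   Context: $G=(V,E)$ is a finite undirected graph with a matching $M$, with at least one unmatched vertex. Alternating paths are simple paths alternating between unmatched edges (not in $M$) and matched edges (in $M$), starting with an unmatched edge when starting at an unmatched vertex. $l_m$ is the minimum length of an augmenting path (alternating path between two distinct unmatched vertices), $\infty$ if none. $\mathrm{evenlevel}(v)$, $\mathrm{oddlevel}(v)$ are the minimum lengths of even, resp. odd, alternating paths from an unmatched vertex to $v$ ($\infty$ if none); such minimum paths are $\mathrm{evenlevel}(v)$, $\mathrm{oddlevel}(v)$ paths. Tenacity $t(v)=\mathrm{evenlevel}(v)+\mathrm{oddlevel}(v)$. For $t(v)=t<l_m$, $\mathrm{base}(v)$ is the vertex of tenacity $>t$ furthest from the starting unmatched vertex along any $\mathrm{evenlevel}(v)$ or $\mathrm{oddlevel}(v)$ path (known to be independent of the path). Iterated bases: $\mathrm{base}^1(v)=\mathrm{base}(v)$, and $\mathrm{base}^{k+1}(v)=\mathrm{base}(\mathrm{base}^k(v))$ whenever $t(\mathrm{base}^k(v))<l_m$. A vertex $v$ has all iterated bases defined if $\mathrm{base}^k(v)$ is defined and is an unmatched vertex for some $k\in\mathbb{Z}^+$. -}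

module Defs where

open import Data.Nat using (ℕ; zero; suc; _+_; _∸_; _<_; _≤_; _%_)
open import Data.Fin using (Fin; toℕ)
open import Data.List using (List; []; _∷_; length; last; lookup)
open import Data.List.Membership.Propositional using (_∈_)
open import Data.List.Relation.Unary.Unique.Propositional using (Unique)
open import Data.Maybe using (just)
open import Data.Product using (Σ; ∃; _×_; _,_)
open import Data.Sum using (_⊎_)
open import Relation.Binary.PropositionalEquality using (_≡_; _≢_)
open import Relation.Nullary using (¬_)
open import Data.Empty using (⊥)

data AltFlag : Set where
  unmat mat : AltFlag

record Graph (n : ℕ) : Set₁ where
  field
    Adj    : Fin n → Fin n → Set
    sym    : ∀ {u v} → Adj u v → Adj v u
    irrefl : ∀ {u} → ¬ Adj u u

record Matching {n : ℕ} (G : Graph n) : Set₁ where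
  open Graph G
  field
    M      : Fin n → Fin n → Set
    M⊆E    : ∀ {u v} → M u v → Adj u v
    M-sym  : ∀ {u v} → M u v → M v u
    M-uniq : ∀ {u v w} → M u v → M u w → v ≡ w

module _ {n : ℕ} (G : Graph n) (Mt : Matching G) where
  open Graph G
  open Matching Mt

  V : Set
  V = Fin n

  Unmatched : V → Set
  Unmatched v = ∀ w → ¬ M v w

  data Alt : AltFlag → List V → Set where
    single : ∀ {b x} → Alt b (x ∷ [])
    unm    : ∀ {x y p} → Adj x y → ¬ M x y → Alt mat (y ∷ p) → Alt unmat (x ∷ y ∷ p)
    mtc    : ∀ {x y p} → M x y → Alt unmat (y ∷ p) → Alt mat (x ∷ y ∷ p)

  len : List V → ℕ
  len p = length p ∸ 1

  AltPath : List V → Set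
  AltPath [] = ⊥
  AltPath (s ∷ q) = Unmatched s × Unique (s ∷ q) × Alt unmat (s ∷ q)

  AltPathTo : V → List V → Set
  AltPathTo v p = AltPath p × last p ≡ just v

  EvenPath OddPath : V → List V → Set
  EvenPath v p = AltPathTo v p × len p % 2 ≡ 0
  OddPath  v p = AltPathTo v p × len p % 2 ≡ 1

  AugPath : List V → Set
  AugPath [] = ⊥
  AugPath (s ∷ q) = Σ V λ w → AltPathTo w (s ∷ q) × Unmatched w × w ≢ s

  -- t < l_m  (l_m = minimum augmenting path length, ∞ if none)
  BelowLm : ℕ → Set
  BelowLm t = ∀ p → AugPath p → t < len p

  EvenLevelPath OddLevelPath : V → List V → Set
  EvenLevelPath v p = EvenPath v p × (∀ q → EvenPath v q → len p ≤ len q)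
  OddLevelPath  v p = OddPath v p × (∀ q → OddPath v q → len p ≤ len q)

  -- evenlevel(v) = k, oddlevel(v) = k  (finite values)
  EvenLevel OddLevel : V → ℕ → Set
  EvenLevel v k = Σ (List V) λ p → EvenLevelPath v p × len p ≡ k
  OddLevel  v k = Σ (List V) λ p → OddLevelPath v p × len p ≡ k

  -- t(v) = t  (finite tenacity)
  Tenacity : V → ℕ → Set
  Tenacity v t = Σ ℕ λ e → Σ ℕ λ o → EvenLevel v e × OddLevel v o × t ≡ e + o

  -- t(w) > t  (including t(w) = ∞)
  TenGT : V → ℕ → Set
  TenGT w t = ∀ t' → Tenacity w t' → t < t'

  Furthest : (V → Set) → List V → V → Set
  Furthest P p b = Σ (Fin (length p)) λ i →
    lookup p i ≡ b × P b ×
    (∀ j → toℕ i < toℕ j → ¬ P (lookup p j))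

  IsBase : V → V → Set
  IsBase v b = Σ ℕ λ t → Tenacity v t × BelowLm t ×
    (∀ p → EvenLevelPath v p ⊎ OddLevelPath v p →
       Furthest (λ w → TenGT w t) p b)

  -- IterBase v k b : base^(k+1)(v) = b
  data IterBase : V → ℕ → V → Set where
    base1 : ∀ {v b} → IsBase v b → IterBase v zero b
    baseS : ∀ {v k c b} → IterBase v k c → IsBase c b → IterBase v (suc k) b

  AllIterBasesDefined : V → Set
  AllIterBasesDefined v = Σ ℕ λ k → Σ V λ b → IterBase v k b × Unmatched b

{-# OPTIONS --safe #-}

-- Double every vertex v into two states (v , parity). Alternating paths become paths of states that
-- meet no vertex twice, and flipping parities (σ) reverses every edge. If a path r runs into a path p
-- ending at v, then at their first common vertex one can turn into p, either forward to v or backward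
-- along the σ-image of p. These exchanges show that a shortest path to v is shortest ("honest") at every
-- state on it whose tenacity is at least that of v.
--
-- By induction on k, every state z of tenacity below k has a well-defined base at threshold k: the last
-- state of tenacity ≥ k is the same on all shortest paths to z and to σ z. The key step describes a
-- shortest path to v at a dishonest predecessor y of v: the base of y is then σ v, and p ran through the
-- blossom of σ v in reverse, so that the σ-reversal of that part of p is itself part of a shortest path.
-- Hence the base of any u on p lies on p: behind u if p is honest at u, and otherwise (by induction on the
-- tenacity of the endpoint) on the reversed part.
--
-- Adjacency is not decidable, so shortest paths exist only up to double negation; this suffices because
-- b ∈ p is decidable.

module Submission where

open import Defs
open import Algebra.Properties.CommutativeSemigroup using (interchange)
import Data.Bool as Bool
open import Data.Bool using (Bool; true; false; not; T; _∧_)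
open import Data.Bool.Properties using (not-involutive; T-∧)
open import Data.Empty using (⊥; ⊥-elim)
open import Data.Fin using (Fin; zero; suc)
import Data.Fin.Properties as Fin
open import Data.List using (List; []; _∷_; _++_; _∷ʳ_; _ʳ++_; length; map; last; reverse)
open import Data.List.Membership.Propositional using (_∈_; find; lose)
import Data.List.Membership.DecPropositional as DecMembership
open import Data.List.Membership.Propositional.Properties using (∈-++⁺ˡ; ∈-++⁺ʳ; ∈-++⁻; ∈-∃++; ∈-map⁺; ∈-map⁻)
open import Data.List.Properties using (length-++; ++-assoc; ∷ʳ-++; ∷-injective; length-map; length-reverse)
open import Data.List.Properties using (map-++; map-ʳ++; reverse-++; reverse-involutive; unfold-reverse)
open import Data.List.Relation.Unary.All using (All; []; _∷_)
import Data.List.Relation.Unary.All as All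
open import Data.List.Relation.Unary.AllPairs using ([]; _∷_)
open import Data.List.Relation.Unary.Any using (here; there; any?; index)
open import Data.List.Relation.Unary.Any.Properties using (lookup-index; reverse⁺; reverse⁻)
open import Data.List.Relation.Unary.Unique.Propositional using (Unique)
open import Data.Maybe using (just)
open import Data.Maybe.Properties using (just-injective)
open import Data.Nat using (ℕ; zero; suc; _+_; _*_; _∸_; _%_; _≤_; _<_; _≤?_; _<?_; _≤ᵇ_; _<ᵇ_; z≤n; s≤s)
open import Data.Nat.Properties
open import Data.Product using (Σ; ∃; _×_; _,_; proj₁; proj₂)
open import Data.Product.Properties using (≡-dec)
open import Data.Sum using (_⊎_; inj₁; inj₂; [_,_]′)
import Data.Vec as Vec
open import Data.Vec using (Vec; []; _∷_)
open import Data.Vec.N-ary using (N-ary; _$ⁿ_)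
open import Effect.Monad using (RawMonad)
open import Function.Bundles using (Equivalence)
open import Relation.Binary.Definitions using (DecidableEquality)
open import Relation.Binary.PropositionalEquality using (_≡_; _≢_; refl; sym; trans; cong; cong₂; subst; subst₂)
open import Relation.Nullary using (¬_; Dec; yes; no)
open import Relation.Nullary.Decidable using (decidable-stable)
open import Relation.Nullary.Negation using (¬¬-Monad)

-- Linear inequalities over ℕ, refuted by adding them up.

infixl 6 _⊞_
infix 4 _≼_

data Lin (n : ℕ) : Set where
  var : Fin n → Lin n
  con : ℕ → Lin n
  _⊞_ : Lin n → Lin n → Lin n

record Ineq (n : ℕ) : Set where
  constructor _≼_
  field lhs rhs : Lin n
open Ineq

⟦_⟧ : ∀ {n} → Lin n → Vec ℕ n → ℕ
⟦ var i ⟧ ρ = Vec.lookup ρ i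
⟦ con c ⟧ ρ = c
⟦ d ⊞ e ⟧ ρ = ⟦ d ⟧ ρ + ⟦ e ⟧ ρ

Holds : ∀ {n} → Vec ℕ n → Ineq n → Set
Holds ρ (d ≼ e) = ⟦ d ⟧ ρ ≤ ⟦ e ⟧ ρ

dot : ∀ {n} → Vec ℕ n → Vec ℕ n → ℕ
dot []      []      = 0
dot (c ∷ v) (r ∷ ρ) = c * r + dot v ρ

dot-0 : ∀ {n} (ρ : Vec ℕ n) → dot (Vec.replicate n 0) ρ ≡ 0
dot-0 []      = refl
dot-0 (r ∷ ρ) = dot-0 ρ

unit : ∀ {n} → Fin n → Vec ℕ n
unit {suc n} zero    = 1 ∷ Vec.replicate n 0
unit         (suc i) = 0 ∷ unit i

dot-unit : ∀ {n} i (ρ : Vec ℕ n) → dot (unit i) ρ ≡ Vec.lookup ρ i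
dot-unit zero    (r ∷ ρ) = trans (cong (r + 0 +_) (dot-0 ρ)) (trans (+-identityʳ _) (+-identityʳ r))
dot-unit (suc i) (r ∷ ρ) = dot-unit i ρ

dot-+ : ∀ {n} (v w ρ : Vec ℕ n) → dot (Vec.zipWith _+_ v w) ρ ≡ dot v ρ + dot w ρ
dot-+ []      []      []      = refl
dot-+ (c ∷ v) (d ∷ w) (r ∷ ρ) rewrite dot-+ v w ρ | *-distribʳ-+ r c d =
  interchange +-commutativeSemigroup (c * r) (d * r) (dot v ρ) (dot w ρ)

const : ∀ {n} → Lin n → ℕ
const (var i) = 0
const (con c) = c
const (d ⊞ e) = const d + const e

coef : ∀ {n} → Lin n → Vec ℕ n
coef     (var i) = unit i
coef {n} (con c) = Vec.replicate n 0
coef     (d ⊞ e) = Vec.zipWith _+_ (coef d) (coef e)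

normal : ∀ {n} (e : Lin n) ρ → ⟦ e ⟧ ρ ≡ const e + dot (coef e) ρ
normal (var i) ρ = sym (dot-unit i ρ)
normal (con c) ρ = sym (trans (cong (c +_) (dot-0 ρ)) (+-identityʳ c))
normal (d ⊞ e) ρ rewrite normal d ρ | normal e ρ | dot-+ (coef d) (coef e) ρ =
  interchange +-commutativeSemigroup (const d) (dot (coef d) ρ) (const e) (dot (coef e) ρ)

_≤ᵛ_ : ∀ {n} → Vec ℕ n → Vec ℕ n → Bool
[]      ≤ᵛ []      = true
(c ∷ v) ≤ᵛ (d ∷ w) = (c ≤ᵇ d) ∧ (v ≤ᵛ w)

dot-mono : ∀ {n} (v w ρ : Vec ℕ n) → T (v ≤ᵛ w) → dot v ρ ≤ dot w ρ
dot-mono []      []      []      _ = z≤n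
dot-mono (c ∷ v) (d ∷ w) (r ∷ ρ) t =
  let (c≤d , v≤w) = Equivalence.to T-∧ t in
  +-mono-≤ (*-monoˡ-≤ r (≤ᵇ⇒≤ c d c≤d)) (dot-mono v w ρ v≤w)

total : ∀ {n} → List (Ineq n) → Ineq n
total []             = con 0 ≼ con 0
total ((d ≼ e) ∷ hs) = d ⊞ lhs (total hs) ≼ e ⊞ rhs (total hs)

total-holds : ∀ {n} {ρ : Vec ℕ n} hs → All (Holds ρ) hs → Holds ρ (total hs)
total-holds []       []       = z≤n
total-holds (h ∷ hs) (p ∷ ps) = +-mono-≤ p (total-holds hs ps)

absurd? : ∀ {n} → Ineq n → Bool
absurd? (d ≼ e) = (const e <ᵇ const d) ∧ (coef e ≤ᵛ coef d)

absurd-sound : ∀ {n} (h : Ineq n) {ρ} → T (absurd? h) → Holds ρ h → ⊥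
absurd-sound (d ≼ e) {ρ} t d≤e =
  let (c , v) = Equivalence.to T-∧ t in
  <-irrefl refl (<-≤-trans (+-mono-<-≤ (<ᵇ⇒< (const e) (const d) c) (dot-mono (coef e) (coef d) ρ v))
    (≤-trans (≤-reflexive (sym (normal d ρ))) (≤-trans d≤e (≤-reflexive (normal e ρ)))))

-- Adding up all hypotheses must give an inequality that is false coefficientwise; a hypothesis that is
-- needed with multiplicity m has to be listed m times.
refute : ∀ n (f : N-ary n (Lin n) (List (Ineq n))) →
         let hs = f $ⁿ Vec.map var (Vec.allFin n) in {T (absurd? (total hs))} →
         (ρ : Vec ℕ n) → All (Holds ρ) hs → ⊥
refute n f {t} ρ ps = absurd-sound (total hs) {ρ} t (total-holds hs ps)
  where hs = f $ⁿ Vec.map var (Vec.allFin n)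

-- Splittings of lists.

module _ {A : Set} where

  lastFrom : A → List A → A
  lastFrom x []      = x
  lastFrom x (y ∷ l) = lastFrom y l

  lastFrom-∷ʳ : ∀ x l {u} → lastFrom x (l ∷ʳ u) ≡ u
  lastFrom-∷ʳ x []      = refl
  lastFrom-∷ʳ x (y ∷ l) = lastFrom-∷ʳ y l

  lastFrom-split : ∀ {y C u} pre P → pre ∷ʳ u ≡ P ++ y ∷ C → lastFrom y C ≡ u
  lastFrom-split []            []          refl = refl
  lastFrom-split []            (_ ∷ [])    ()
  lastFrom-split []            (_ ∷ _ ∷ _) ()
  lastFrom-split (x ∷ pre)     []          refl = lastFrom-∷ʳ x pre
  lastFrom-split (x ∷ pre)     (_ ∷ P)     eq   = lastFrom-split pre P (proj₂ (∷-injective eq))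

  length-∷ʳ : ∀ l {u : A} → length (l ∷ʳ u) ≡ suc (length l)
  length-∷ʳ l = trans (length-++ l) (+-comm (length l) 1)

  ++-∷-≢[] : ∀ {x : A} {Q} P → P ++ x ∷ Q ≢ []
  ++-∷-≢[] []      ()
  ++-∷-≢[] (_ ∷ _) ()

  -- Compares the marked positions of two splittings of one list; `m` is the stretch between them.
  -- For the backward lists of paths below, `before` means later on the path.
  data Order (P : List A) (x : A) (Q P′ : List A) (x′ : A) (Q′ : List A) : Set where
    before : ∀ m → P′ ≡ P ++ x ∷ m → Q ≡ m ++ x′ ∷ Q′ → Order P x Q P′ x′ Q′
    equal  : P ≡ P′ → x ≡ x′ → Q ≡ Q′ → Order P x Q P′ x′ Q′
    after  : ∀ m → P ≡ P′ ++ x′ ∷ m → Q′ ≡ m ++ x ∷ Q → Order P x Q P′ x′ Q′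

  order : ∀ {x Q x′ Q′} P P′ → P ++ x ∷ Q ≡ P′ ++ x′ ∷ Q′ → Order P x Q P′ x′ Q′
  order []      []       refl = equal refl refl refl
  order []      (_ ∷ P′) refl = before P′ refl refl
  order (_ ∷ P) []       refl = after P refl refl
  order (p ∷ P) (p′ ∷ P′) eq with ∷-injective eq
  ... | refl , eq′ with order P P′ eq′
  ...   | before m e f  = before m (cong (p ∷_) e) f
  ...   | equal e f g   = equal (cong (p ∷_) e) f g
  ...   | after m e f   = after m (cong (p ∷_) e) f

-- States with parity and the flip `σ`.

module Skew {Vertex : Set} (_≟_ : DecidableEquality Vertex) where

  X : Set
  X = Vertex × Bool

  σ : X → X
  σ (v , b) = v , not b

  σσ : ∀ x → σ (σ x) ≡ x
  σσ (v , b) = cong (v ,_) (not-involutive b)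

  same-vertex : ∀ {x y} → proj₁ x ≡ proj₁ y → x ≡ y ⊎ x ≡ σ y
  same-vertex {_ , false} {_ , false} refl = inj₁ refl
  same-vertex {_ , false} {_ , true}  refl = inj₂ refl
  same-vertex {_ , true}  {_ , false} refl = inj₂ refl
  same-vertex {_ , true}  {_ , true}  refl = inj₁ refl

  Disjoint : List X → List X → Set
  Disjoint P Q = ∀ {a b} → a ∈ P → b ∈ Q → proj₁ a ≢ proj₁ b

  infixl 5 _⟲_
  -- Reverse-append combined with `σ`: the path `r` continues by walking back along `C` in flipped
  -- states.
  _⟲_ : List X → List X → List X
  []      ⟲ r = r
  (c ∷ C) ⟲ r = C ⟲ (σ c ∷ r)

  length-⟲ : ∀ C {r} → length (C ⟲ r) ≡ length C + length r
  length-⟲ []            = refl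
  length-⟲ (c ∷ C) {r} = trans (length-⟲ C) (+-suc (length C) (length r))

  ⟲-++ : ∀ C {r r′} → C ⟲ (r ++ r′) ≡ (C ⟲ r) ++ r′
  ⟲-++ []      = refl
  ⟲-++ (c ∷ C) = ⟲-++ C

  ∈-⟲⁻ : ∀ C {r z} → z ∈ C ⟲ r → (∃ λ c → c ∈ C × z ≡ σ c) ⊎ z ∈ r
  ∈-⟲⁻ []      z∈ = inj₂ z∈
  ∈-⟲⁻ (c ∷ C) z∈ with ∈-⟲⁻ C z∈
  ... | inj₁ (d , d∈ , eq) = inj₁ (d , there d∈ , eq)
  ... | inj₂ (here eq)     = inj₁ (c , here refl , eq)
  ... | inj₂ (there z∈r)   = inj₂ z∈r

  ∈-⟲⁺ʳ : ∀ C {r z} → z ∈ r → z ∈ C ⟲ r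
  ∈-⟲⁺ʳ []      z∈ = z∈
  ∈-⟲⁺ʳ (c ∷ C) z∈ = ∈-⟲⁺ʳ C (there z∈)

  ∈-⟲⁺ˡ : ∀ {C r c} → c ∈ C → σ c ∈ C ⟲ r
  ∈-⟲⁺ˡ {_ ∷ C} (here refl) = ∈-⟲⁺ʳ C (here refl)
  ∈-⟲⁺ˡ {_ ∷ C} (there c∈)  = ∈-⟲⁺ˡ {C} c∈

  -- Since `r` is read backwards, `clear` makes `z` the first state of the path whose vertex occurs
  -- on `S`.
  record Hit (S r : List X) : Set where
    constructor mkHit
    field
      {P C}    : List X
      {y z}    : X
      {Q r′}   : List X
      split-S  : S ≡ P ++ y ∷ C
      split-r  : r ≡ Q ++ z ∷ r′
      meet     : proj₁ z ≡ proj₁ y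
      clear    : Disjoint S r′

  hit? : ∀ S r → Disjoint S r ⊎ Hit S r
  hit? S []      = inj₁ λ _ ()
  hit? S (x ∷ r) with hit? S r
  ... | inj₂ (mkHit e f g h) = inj₂ (mkHit {Q = x ∷ _} e (cong (x ∷_) f) g h)
  ... | inj₁ dis with any? (λ y → proj₁ x ≟ proj₁ y) S
  ...   | yes a = let (y , y∈ , eq) = find a ; (P , C , e) = ∈-∃++ y∈ in
                  inj₂ (mkHit {Q = []} e refl eq dis)
  ...   | no ¬a = inj₁ λ where
            a∈ (here refl) eq → ¬a (lose a∈ (sym eq))
            a∈ (there b∈)  eq → dis a∈ b∈ eq

  -- Paths of states and their exchanges.

  module Paths
    (E : X → X → Set) (E-skew : ∀ {x y} → E x y → E (σ y) (σ x))
    (Start : X → Set) where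

    -- The list runs backwards: its head is the endpoint, so prefixes of a path are suffixes of its list.
    data Path : X → List X → Set where
      start : ∀ {s} → Start s → Path s (s ∷ [])
      step  : ∀ {x y l} → Path x (x ∷ l) → E x y →
              (∀ {z} → z ∈ x ∷ l → proj₁ y ≢ proj₁ z) → Path y (y ∷ x ∷ l)

    path-head : ∀ {v x l} → Path v (x ∷ l) → v ≡ x
    path-head (start _)    = refl
    path-head (step _ _ _) = refl

    path-∈ : ∀ {v l} → Path v l → v ∈ l
    path-∈ (start _)    = here refl
    path-∈ (step _ _ _) = here refl

    grow : ∀ {x y l} → Path x l → E x y → (∀ {z} → z ∈ l → proj₁ y ≢ proj₁ z) → Path y (y ∷ l)
    grow p@(start _)    = step p
    grow p@(step _ _ _) = step p

    path-edge : ∀ {v x y l} → Path v (y ∷ x ∷ l) → E x y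
    path-edge (step _ e _) = e

    path-fresh : ∀ {v x z l} → Path v (x ∷ l) → z ∈ l → proj₁ x ≢ proj₁ z
    path-fresh (step _ _ f) = f

    path-suffix : ∀ {v u rest} pre → Path v (pre ++ u ∷ rest) → Path u (u ∷ rest)
    path-suffix [] p with path-head p
    ... | refl = p
    path-suffix (_ ∷ [])      (step p _ _) = p
    path-suffix (_ ∷ a ∷ pre) (step p _ _) = path-suffix (a ∷ pre) p

    path-disjoint : ∀ {v Q} P → Path v (P ++ Q) → Disjoint P Q
    path-disjoint (a ∷ P)     p            (here refl) b∈ = path-fresh p (∈-++⁺ʳ P b∈)
    path-disjoint (a ∷ b ∷ P) (step p _ _) (there a∈)  b∈ = path-disjoint (b ∷ P) p a∈ b∈

    -- Forward exchange: the final stretch `P` is kept and the beginning of the path is replaced.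
    splice : ∀ {v y rest r} P → Path v (P ++ y ∷ rest) → Path y (y ∷ r) →
          Disjoint P (y ∷ r) → Path v (P ++ y ∷ r)
    splice [] p q dis with path-head p
    ... | refl = q
    splice (a ∷ []) (step p e f) q dis = step q e λ z∈ → dis (here refl) z∈
    splice {y = y} {r = r} (a ∷ b ∷ P) (step p e f) q dis =
      step (splice (b ∷ P) p q λ a∈ → dis (there a∈)) e fresh
      where
      fresh : ∀ {z} → z ∈ b ∷ P ++ y ∷ r → proj₁ a ≢ proj₁ z
      fresh z∈ with ∈-++⁻ (b ∷ P) z∈
      ... | inj₁ z∈P = f (∈-++⁺ˡ z∈P)
      ... | inj₂ z∈r = dis (here refl) z∈r

    -- Backward exchange: `E-skew` lets the stretch `C` be walked in the opposite direction. `x̄` is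
    -- kept apart from `σ x` so that a path to `x` itself can serve where the stretch begins at
    -- `σ x`.
    retrace : ∀ {w x x̄ r rest} C → Path w (x ∷ C ++ rest) → x̄ ≡ σ x → Path x̄ (x̄ ∷ r) →
          Disjoint C (x̄ ∷ r) → Path (σ (lastFrom x C)) (C ⟲ (x̄ ∷ r))
    retrace []      p refl q dis = q
    retrace {x = x} {r = r} (c ∷ C) (step p e f) refl q dis =
      retrace C p refl (step q (E-skew e) λ z∈ → dis (here refl) z∈) dis′
      where
      dis′ : Disjoint C (σ c ∷ σ x ∷ r)
      dis′ a∈ (here refl) eq = path-fresh p (∈-++⁺ˡ a∈) (sym eq)
      dis′ a∈ (there b∈)  eq = dis (there a∈) b∈ eq

    -- r reaches its first vertex on p = pre ++ u ∷ rest (before u counts as off p) either in the state y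
    -- used by p, or in the state σ y, from where p can only be followed backwards.
    data Cross (v : X) (pre : List X) (u : X) (r : List X) : Set where
      same : ∀ P y C Q r′ → pre ∷ʳ u ≡ P ++ y ∷ C → length pre ≡ length P + length C →
             r ≡ Q ++ y ∷ r′ → Path v (P ++ y ∷ r′) → Cross v pre u r
      opp  : ∀ P y C Q r′ → pre ∷ʳ u ≡ P ++ y ∷ C → length pre ≡ length P + length C →
             r ≡ Q ++ σ y ∷ r′ → Disjoint (pre ∷ʳ u) r′ →
             Path (σ u) (C ⟲ (σ y ∷ r′)) → Cross v pre u r

    -- Up to its first contact, `r` avoids the whole stretch `pre ∷ʳ u`, so whichever exchange fits
    -- the state at the contact meets its disjointness condition.
    cross : ∀ {v w u pre rest r} → Path v (pre ++ u ∷ rest) → Path w r →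
            Disjoint (pre ∷ʳ u) r ⊎ Cross v pre u r
    cross {v} {u = u} {pre} {rest} {r} p q with hit? (pre ∷ʳ u) r
    ... | inj₁ dis = inj₁ dis
    ... | inj₂ (mkHit {P} {C} {y} {z} {Q} {r′} e refl meet clear) = inj₂ (found (same-vertex meet))
      where
      count : length pre ≡ length P + length C
      count = suc-injective (trans (sym (length-∷ʳ pre))
              (trans (cong length e) (trans (length-++ P) (+-suc _ _))))
      p′ : Path v (P ++ y ∷ (C ++ rest))
      p′ = subst (Path v)
             (trans (sym (∷ʳ-++ pre u rest)) (trans (cong (_++ rest) e) (++-assoc P _ rest))) p
      disˡ : z ≡ y → Disjoint P (y ∷ r′)
      disˡ refl a∈ (here refl) eq = path-disjoint P p′ a∈ (here refl) eq
      disˡ refl a∈ (there b∈)  eq = clear (subst (_ ∈_) (sym e) (∈-++⁺ˡ a∈)) b∈ eq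
      disʳ : Disjoint C (σ y ∷ r′)
      disʳ a∈ (here refl) eq = path-fresh (path-suffix P p′) (∈-++⁺ˡ a∈) (sym eq)
      disʳ a∈ (there b∈)  eq = clear (subst (_ ∈_) (sym e) (∈-++⁺ʳ P (there a∈))) b∈ eq
      found : z ≡ y ⊎ z ≡ σ y → Cross v pre u (Q ++ z ∷ r′)
      found (inj₁ refl) = same P y C Q r′ e count refl (splice P p′ (path-suffix Q q) (disˡ refl))
      found (inj₂ refl) = opp P y C Q r′ e count refl clear
        (subst (λ x → Path (σ x) (C ⟲ (σ y ∷ r′))) (lastFrom-split pre P e)
          (retrace C (path-suffix P p′) refl (path-suffix Q q) disʳ))

    -- D counts the states of a shortest path, i.e. one more than its edges; on unreachable states it is
    -- an arbitrary value ≥ L.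
    module Levels
      (D : X → ℕ) (L : ℕ)
      (D-least  : ∀ {x l} → Path x l → D x ≤ length l)
      (D-attain : ∀ {x} → D x < L → ∃ λ l → Path x l × length l ≡ D x)
      (start-late : ∀ {s} → Start s → L ≤ D s + D (σ s)) where

      -- Tenacity of states, and honest states on shortest paths.

      ten : X → ℕ
      ten x = D x + D (σ x)

      ten-σ : ∀ x → ten (σ x) ≡ ten x
      ten-σ x = trans (cong (λ z → D (σ x) + D z) (σσ x)) (+-comm (D (σ x)) (D x))

      Shortest : X → List X → Set
      Shortest x l = Path x l × length l ≡ D x

      shortest : ∀ {x} → ten x < L → ∃ (Shortest x)
      shortest t<L = D-attain (≤-<-trans (m≤m+n _ _) t<L)

      shortest-σ : ∀ {x} → ten x < L → ∃ (Shortest (σ x))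
      shortest-σ t<L = D-attain (≤-<-trans (m≤n+m _ _) t<L)

      length-pre : ∀ {v u rest} pre → Shortest v (pre ++ u ∷ rest) →
                   D v ≡ length pre + suc (length rest)
      length-pre pre (_ , eq) = trans (sym eq) (length-++ pre)

      suffix-≤ : ∀ {v u rest} pre → Shortest v (pre ++ u ∷ rest) → suc (length rest) ≤ D v
      suffix-≤ pre s = ≤-trans (m≤n+m _ _) (≤-reflexive (sym (length-pre pre s)))

      D-++ : ∀ {v u rest} pre → Path v (pre ++ u ∷ rest) → D v ≤ length pre + suc (length rest)
      D-++ pre p = ≤-trans (D-least p) (≤-reflexive (length-++ pre))

      D-⟲ : ∀ {v r} C → Path v (C ⟲ r) → D v ≤ length C + length r
      D-⟲ C p = ≤-trans (D-least p) (≤-reflexive (length-⟲ C))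

      D-suffix : ∀ {v u rest} pre → Path v (pre ++ u ∷ rest) → D u ≤ suc (length rest)
      D-suffix pre p = D-least (path-suffix pre p)

      early-shortest : ∀ {v u rest} pre → Shortest v (pre ++ u ∷ rest) → ¬ D u < suc (length rest) →
                       Shortest u (u ∷ rest)
      early-shortest pre (p , _) ≮ = path-suffix pre p , ≤-antisym (≮⇒≥ ≮) (D-suffix pre p)

      end-∈ : ∀ {v u rest} pre → Path v (pre ++ u ∷ rest) → v ∈ pre ∷ʳ u
      end-∈ []        p = here (path-head p)
      end-∈ (x ∷ pre) p = here (path-head p)

      -- The path to `σ v` must meet the stretch from `u` to `v`. A contact in the flipped state
      -- yields a path to `σ u` and the first bound. At a contact in the same state it has used at
      -- least as many states as the shortest path to `v`, hence at least the position of `u`, which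
      -- is the second bound.
      turn : ∀ {v u r rest} pre → Shortest v (pre ++ u ∷ rest) → Shortest (σ v) r →
             D (σ u) + suc (length rest) ≤ ten v ⊎ suc (length rest) ≤ D (σ v)
      turn {v} {u} {r} {rest} pre s@(p , _) s′@(q , _) with cross {pre = pre} p q
      ... | inj₁ dis = ⊥-elim (dis (end-∈ pre p) (path-∈ q) refl)
      ... | inj₂ (same P y C Q r′ _ len refl new) = inj₂ (≮⇒≥ λ lt →
        refute 8 (λ dv dσv pre P C Q r′ i →
            (con 1 ⊞ dσv ≼ con 1 ⊞ i) ∷ (P ⊞ C ≼ pre) ∷ (pre ⊞ (con 1 ⊞ i) ≼ dv) ∷
            (Q ⊞ (con 1 ⊞ r′) ≼ dσv) ∷ (dv ≼ P ⊞ (con 1 ⊞ r′)) ∷ [])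
          (D v ∷ D (σ v) ∷ length pre ∷ length P ∷ length C ∷ length Q ∷ length r′ ∷ length rest ∷ [])
          (lt ∷ ≤-reflexive (sym len) ∷ ≤-reflexive (sym (length-pre pre s)) ∷
           ≤-reflexive (sym (length-pre Q s′)) ∷ D-++ P new ∷ []))
      ... | inj₂ (opp P y C Q r′ _ len refl _ new) = inj₁ (≮⇒≥ λ lt →
        refute 9 (λ dv dσv dσu pre P C Q r′ i →
            (con 1 ⊞ (dv ⊞ dσv) ≼ dσu ⊞ (con 1 ⊞ i)) ∷ (P ⊞ C ≼ pre) ∷ (pre ⊞ (con 1 ⊞ i) ≼ dv) ∷
            (Q ⊞ (con 1 ⊞ r′) ≼ dσv) ∷ (dσu ≼ C ⊞ (con 1 ⊞ r′)) ∷ [])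
          (D v ∷ D (σ v) ∷ D (σ u) ∷ length pre ∷ length P ∷ length C ∷ length Q ∷ length r′ ∷ length rest ∷ [])
          (lt ∷ ≤-reflexive (sym len) ∷ ≤-reflexive (sym (length-pre pre s)) ∷
           ≤-reflexive (sym (length-pre Q s′)) ∷ D-⟲ C new ∷ []))

      -- If `u` could be reached earlier, the first bound of `turn` would contradict `ten v ≤ ten u`
      -- at once. Under the second bound, a shortest path to `u` crosses the stretch from `u` to `v`
      -- and either shortens the path to `v` or reaches `σ u` too soon.
      honest : ∀ {v u rest} pre → ten v < L → Shortest v (pre ++ u ∷ rest) → ten v ≤ ten u →
               Shortest u (u ∷ rest)
      honest {v} {u} {rest} pre t<L s@(p , _) t≤ with D u <? suc (length rest)
      ... | no ≮ = early-shortest pre s ≮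
      ... | yes lt = ⊥-elim (contra (shortest-σ t<L))
        where
        u<L : D u < L
        u<L = <-trans lt (≤-<-trans (suffix-≤ pre s) (≤-<-trans (m≤m+n _ _) t<L))
        contra : ∃ (Shortest (σ v)) → ⊥
        contra (r , sr) with turn pre s sr
        ... | inj₁ h =
          refute 4 (λ du dσu tv i → (con 1 ⊞ du ≼ con 1 ⊞ i) ∷ (dσu ⊞ (con 1 ⊞ i) ≼ tv) ∷ (tv ≼ du ⊞ dσu) ∷ [])
            (D u ∷ D (σ u) ∷ ten v ∷ length rest ∷ []) (lt ∷ h ∷ t≤ ∷ [])
        ... | inj₂ h with D-attain u<L
        ...   | q , pq , eq with cross {pre = pre} p pq
        ...     | inj₁ dis = dis (∈-++⁺ʳ pre (here refl)) (path-∈ pq) refl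
        ...     | inj₂ (same P y C Q r′ _ len refl new) =
          refute 8 (λ dv du pre P C Q r′ i →
              (con 1 ⊞ du ≼ con 1 ⊞ i) ∷ (P ⊞ C ≼ pre) ∷ (pre ⊞ (con 1 ⊞ i) ≼ dv) ∷
              (Q ⊞ (con 1 ⊞ r′) ≼ du) ∷ (dv ≼ P ⊞ (con 1 ⊞ r′)) ∷ [])
            (D v ∷ D u ∷ length pre ∷ length P ∷ length C ∷ length Q ∷ length r′ ∷ length rest ∷ [])
            (lt ∷ ≤-reflexive (sym len) ∷ ≤-reflexive (sym (length-pre pre s)) ∷
             ≤-reflexive (sym (length-pre Q (pq , eq))) ∷ D-++ P new ∷ [])
        -- The short path to `u` also yields a short one to `σ u`, so its length counts twice and
        -- `ten u` drops below `ten v`.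
        ...     | inj₂ (opp P y C Q r′ _ len refl _ new) =
          refute 10 (λ dv du dσv dσu pre P C Q r′ i →
              (con 1 ⊞ du ≼ con 1 ⊞ i) ∷ (con 1 ⊞ du ≼ con 1 ⊞ i) ∷ (con 1 ⊞ i ≼ dσv) ∷
              (dv ⊞ dσv ≼ du ⊞ dσu) ∷ (P ⊞ C ≼ pre) ∷ (pre ⊞ (con 1 ⊞ i) ≼ dv) ∷
              (Q ⊞ (con 1 ⊞ r′) ≼ du) ∷ (dσu ≼ C ⊞ (con 1 ⊞ r′)) ∷ [])
            (D v ∷ D u ∷ D (σ v) ∷ D (σ u) ∷ length pre ∷ length P ∷ length C ∷
             length Q ∷ length r′ ∷ length rest ∷ [])
            (lt ∷ lt ∷ h ∷ t≤ ∷ ≤-reflexive (sym len) ∷ ≤-reflexive (sym (length-pre pre s)) ∷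
             ≤-reflexive (sym (length-pre Q (pq , eq))) ∷ D-⟲ C new ∷ [])

      -- The first bound of `turn` is incompatible with `ten v < ten u`; by the second, twice the
      -- position of `u` is at most `ten v`, so `D (σ u)` must be the larger summand of `ten u`.
      outer : ∀ {v u rest} pre → ten v < L → Shortest v (pre ++ u ∷ rest) → ten v < ten u →
              D u < D (σ u)
      outer {v} {u} {rest} pre t<L s@(p , _) t< with D u <? D (σ u)
      ... | yes lt = lt
      ... | no ≮ with turn pre s (proj₂ (shortest-σ t<L))
      ...   | inj₁ h = ⊥-elim (
        refute 4 (λ tv du dσu i → (con 1 ⊞ tv ≼ du ⊞ dσu) ∷ (dσu ⊞ (con 1 ⊞ i) ≼ tv) ∷ (du ≼ con 1 ⊞ i) ∷ [])
          (ten v ∷ D u ∷ D (σ u) ∷ length rest ∷ []) (t< ∷ h ∷ D-suffix pre p ∷ []))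
      ...   | inj₂ h = ⊥-elim (
        refute 5 (λ dv dσv du dσu i → (con 1 ⊞ (dv ⊞ dσv) ≼ du ⊞ dσu) ∷ (dσu ≼ du) ∷ (con 1 ⊞ i ≼ dσv) ∷
            (con 1 ⊞ i ≼ dv) ∷ (du ≼ con 1 ⊞ i) ∷ (du ≼ con 1 ⊞ i) ∷ [])
          (D v ∷ D (σ v) ∷ D u ∷ D (σ u) ∷ length rest ∷ [])
          (t< ∷ ≮⇒≥ ≮ ∷ h ∷ suffix-≤ pre s ∷ D-suffix pre p ∷ D-suffix pre p ∷ []))

      -- Last states above a threshold, and bases.

      record Last (k : ℕ) (l : List X) (c : X) : Set where
        constructor mkLast
        field
          {post rest} : List X
          split : l ≡ post ++ c ∷ rest
          high  : k ≤ ten c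
          low   : ∀ {z} → z ∈ post → ten z < k

      -- The backward search succeeds at the latest in the start state, whose tenacity is at least
      -- `L` by `start-late`.
      last-exists : ∀ {k v l} → k ≤ L → Path v l → ∃ (Last k l)
      last-exists {k} {v} k≤L p with k ≤? ten v
      last-exists k≤L (start s)    | yes h = _ , mkLast {post = []} refl h (λ ())
      last-exists k≤L (step _ _ _) | yes h = _ , mkLast {post = []} refl h (λ ())
      last-exists k≤L (start s)    | no ≰ = ⊥-elim (≰ (≤-trans k≤L (start-late s)))
      last-exists {v = v} k≤L (step p _ _) | no ≰ with last-exists k≤L p
      ... | c , mkLast {post} e h low = c , mkLast {post = v ∷ post} (cong (v ∷_) e) h λ where
        (here refl) → ≰⇒> ≰
        (there z∈)  → low z∈

      last-unique : ∀ {k l c c′} → Last k l c → Last k l c′ → c ≡ c′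
      last-unique (mkLast {P} refl h low) (mkLast {P′} e h′ low′) with order P P′ e
      ... | equal _ c≡c′ _  = c≡c′
      ... | before _ refl _ = ⊥-elim (<⇒≱ (low′ (∈-++⁺ʳ P (here refl))) h)
      ... | after _ refl _  = ⊥-elim (<⇒≱ (low (∈-++⁺ʳ P′ (here refl))) h′)

      last-extend : ∀ {k l c} P → (∀ {z} → z ∈ P → ten z < k) → Last k l c → Last k (P ++ l) c
      last-extend {k} P lowP (mkLast {post} refl h low) =
        mkLast {post = P ++ post} (sym (++-assoc P post _)) h low′
        where
        low′ : ∀ {z} → z ∈ P ++ post → ten z < k
        low′ z∈ with ∈-++⁻ P z∈
        ... | inj₁ i = lowP i
        ... | inj₂ i = low i

      last-drop : ∀ {k l c} P → (∀ {z} → z ∈ P → ten z < k) → Last k (P ++ l) c → Last k l c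
      last-drop []      lowP h = h
      last-drop (a ∷ P) lowP (mkLast {[]} refl h _) = ⊥-elim (<⇒≱ (lowP (here refl)) h)
      last-drop (a ∷ P) lowP (mkLast {_ ∷ _} e h low) =
        last-drop P (λ z∈ → lowP (there z∈)) (mkLast (proj₂ (∷-injective e)) h (λ z∈ → low (there z∈)))

      last-weaken : ∀ {j k l c} → j ≤ k → k ≤ ten c → Last j l c → Last k l c
      last-weaken j≤k h (mkLast e _ low) = mkLast e h λ z∈ → <-≤-trans (low z∈) j≤k

      Base : ℕ → X → X → Set
      Base k x c = ∀ {l} → Shortest x l ⊎ Shortest (σ x) l → Last k l c

      base-σ : ∀ {k x c} → Base k x c → Base k (σ x) c
      base-σ         B (inj₁ s) = B (inj₂ s)
      base-σ {x = x} B (inj₂ s) = B (inj₁ (subst (λ z → Shortest z _) (σσ x) s))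

      base-unique : ∀ {k x c c′} → ten x < L → Base k x c → Base k x c′ → c ≡ c′
      base-unique t<L B B′ = let (_ , s) = shortest t<L in last-unique (B (inj₁ s)) (B′ (inj₁ s))

      base-behind : ∀ {k z c rest} → ten z < k → Base k z c → Shortest z (z ∷ rest) → Last k rest c
      base-behind {z = z} z<k B s = last-drop (z ∷ []) (λ { (here refl) → z<k }) (B (inj₁ s))

      base-closer : ∀ {k z c} → k ≤ L → ten z < k → Base k z c → D c < D z
      base-closer {c = c} k≤L z<k B with shortest (<-≤-trans z<k k≤L)
      ... | l , s with B (inj₁ s)
      ...   | mkLast {[]} refl h low with path-head (proj₁ s)
      ...     | refl = ⊥-elim (<⇒≱ z<k h)
      base-closer k≤L z<k B | l , s | mkLast {a ∷ post} refl h low =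
        ≤-trans (s≤s (D-suffix (a ∷ post) (proj₁ s)))
          (≤-trans (s≤s (m≤n+m _ (length post))) (≤-reflexive (sym (length-pre (a ∷ post) s))))

      -- Dishonest states and detours.

      Bases : ℕ → Set
      Bases k = ∀ x → ten x < k → ∃ (Base k x)

      -- Otherwise r could be extended to v, or already passes v, and is too short for that.
      dishonest-mate : ∀ {v y rest r} → Shortest v (v ∷ y ∷ rest) → D y < suc (length rest) →
                       Shortest y r → σ v ∈ r
      dishonest-mate {v} {y} {rest} {r} (p , eq) lt (q , eq′) with any? (λ z → proj₁ v ≟ proj₁ z) r
      ... | no none = ⊥-elim (refute 4
              (λ dv dy r i → (con 2 ⊞ i ≼ dv) ∷ (dv ≼ con 1 ⊞ r) ∷ (r ≼ dy) ∷ (con 1 ⊞ dy ≼ con 1 ⊞ i) ∷ [])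
              (D v ∷ D y ∷ length r ∷ length rest ∷ [])
              (≤-reflexive eq ∷ D-least (grow q (path-edge p) λ z∈ e → none (lose z∈ e)) ∷ ≤-reflexive eq′ ∷ lt ∷ []))
      ... | yes some with find some
      ...   | z , z∈ , e with same-vertex {z} {v} (sym e)
      ...     | inj₂ refl = z∈
      ...     | inj₁ refl with ∈-∃++ z∈
      ...       | Q , r′ , refl = ⊥-elim (refute 5
              (λ dv dy Q r i → (con 2 ⊞ i ≼ dv) ∷ (dv ≼ con 1 ⊞ r) ∷
                (Q ⊞ (con 1 ⊞ r) ≼ dy) ∷ (con 1 ⊞ dy ≼ con 1 ⊞ i) ∷ [])
              (D v ∷ D y ∷ length Q ∷ length r′ ∷ length rest ∷ [])
              (≤-reflexive eq ∷ D-suffix Q q ∷ ≤-reflexive (sym (length-pre Q (q , eq′))) ∷ lt ∷ []))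

      -- A shortest path to `y` passes `σ v` and is shorter than the one to `v`.
      mate-lower : ∀ {v y rest} → D v < L → Shortest v (v ∷ y ∷ rest) → D y < suc (length rest) →
                   D (σ v) < D v
      mate-lower {v} {y} {rest} t<L s@(p , eq) lt
        with D-attain (<-trans lt (<-trans (≤-reflexive eq) t<L))
      ... | r , q , eq′ with ∈-∃++ (dishonest-mate s lt (q , eq′))
      ...   | Q , r′ , refl = ≰⇒> λ le → refute 6
              (λ dv dσv dy Q r i → (con 2 ⊞ i ≼ dv) ∷ (dv ≼ dσv) ∷ (dσv ≼ con 1 ⊞ r) ∷
                (Q ⊞ (con 1 ⊞ r) ≼ dy) ∷ (con 1 ⊞ dy ≼ con 1 ⊞ i) ∷ [])
              (D v ∷ D (σ v) ∷ D y ∷ length Q ∷ length r′ ∷ length rest ∷ [])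
              (≤-reflexive eq ∷ le ∷ D-suffix Q q ∷ ≤-reflexive (sym (length-pre Q (q , eq′))) ∷ lt ∷ [])

      -- l enters the blossom of σ v at entry, stays inside, and leaves it through its base; the return
      -- path traverses the same part from the base σ v to σ entry.
      record Detour (v : X) (l : List X) : Set where
        constructor mkDetour
        field
          {seg}   : List X
          {entry} : X
          {rest}  : List X
          {back}  : List X
          split  : l ≡ seg ++ entry ∷ rest
          inside : ∀ {z} → z ∈ seg ∷ʳ entry → ten z < ten v × Base (ten v) z (σ v)
          return : Shortest (σ entry) ((seg ∷ʳ entry) ⟲ (σ v ∷ back))
          stop   : ∀ {x l′} → rest ≡ x ∷ l′ → ¬ D x < suc (length l′)

      Detours : ℕ → Set
      Detours k = ∀ {v y rest} → ten v ≡ k → Shortest v (v ∷ y ∷ rest) → D y < suc (length rest) →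
                  Detour v (y ∷ rest)

      -- w is the first honest state after z on the path pp ++ z ∷ rest.
      record Dishonest (v : X) (pp : List X) (z : X) (rest : List X) : Set where
        constructor mkDishonest
        field
          {pp₁ pp₂} : List X
          {w}       : X
          split  : pp ≡ pp₁ ++ w ∷ pp₂
          short  : Shortest w (w ∷ pp₂ ++ z ∷ rest)
          ten≤   : ten w ≤ ten v
          detour : Detour w (pp₂ ++ z ∷ rest)
          within : ∀ {x} → x ∈ pp₂ ∷ʳ z → x ∈ Detour.seg detour ∷ʳ Detour.entry detour

      -- The path `P ++ t` is dishonest at every state of `P`: each has a distance below its
      -- position.
      AllLate : List X → List X → Set
      AllLate P t = ∀ Q {x R} → P ≡ Q ++ x ∷ R → D x < length (x ∷ R ++ t)

      last-early : ∀ P t → AllLate P t ⊎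
                   (∃ λ Q → ∃ λ w → ∃ λ R → P ≡ Q ++ w ∷ R × ¬ D w < length (w ∷ R ++ t) × AllLate R t)
      last-early [] t = inj₁ λ { [] () ; (_ ∷ _) () }
      last-early (x ∷ P) t with last-early P t
      ... | inj₂ (Q , w , R , e , ≮ , late) = inj₂ (x ∷ Q , w , R , cong (x ∷_) e , ≮ , late)
      ... | inj₁ late with D x <? length (x ∷ P ++ t)
      ...   | no ≮  = inj₂ ([] , x , P , refl , ≮ , late)
      ...   | yes l = inj₁ λ where
                []      refl → l
                (_ ∷ Q) refl → late Q refl

      late-head : ∀ {z rest y l} P → AllLate P (z ∷ rest) → D z < suc (length rest) →
                  P ++ z ∷ rest ≡ y ∷ l → D y < suc (length l)
      late-head []      late lt refl = lt
      late-head (x ∷ P) late lt refl = late [] refl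

      end-early : ∀ {v z rest} P → Shortest v (P ++ z ∷ rest) → D z < suc (length rest) →
                  ¬ AllLate P (z ∷ rest)
      end-early []      (p , eq) lt late with path-head p
      ... | refl = <-irrefl (sym eq) lt
      end-early (_ ∷ P) (p , eq) lt late with path-head p
      ... | refl = <-irrefl (sym eq) (late [] refl)

      -- The path is honest at its end `v`, so a first honest `w` after `z` exists; its predecessor
      -- is dishonest, which gives a detour. By `stop` the state visited just before the detour is
      -- honest, whereas `z` and everything up to `w` is not, so the detour covers `z`.
      dishonest : ∀ {v z rest} pp → ten v < L → (∀ {j} → j ≤ ten v → Detours j) →
                  Shortest v (pp ++ z ∷ rest) → D z < suc (length rest) → Dishonest v pp z rest
      dishonest {v} {z} {rest} pp t<L det s lt with last-early pp (z ∷ rest)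
      ... | inj₁ late = ⊥-elim (end-early pp s lt late)
      ... | inj₂ (pp₁ , w , pp₂ , refl , ≮ , late) =
        finish (pp₂ ++ z ∷ rest) refl
        where
        s′ : Shortest v (pp₁ ++ w ∷ pp₂ ++ z ∷ rest)
        s′ = subst (Shortest v) (++-assoc pp₁ (w ∷ pp₂) (z ∷ rest)) s
        sw : Shortest w (w ∷ pp₂ ++ z ∷ rest)
        sw = early-shortest pp₁ s′ ≮
        w<L : D w < L
        w<L = ≤-<-trans (subst (_≤ D v) (proj₂ sw) (suffix-≤ pp₁ s′)) (≤-<-trans (m≤m+n _ _) t<L)
        within : ∀ {l} (d : Detour w l) → pp₂ ++ z ∷ rest ≡ l → ∀ {x} → x ∈ pp₂ ∷ʳ z →
                 x ∈ Detour.seg d ∷ʳ Detour.entry d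
        within (mkDetour {seg} {entry} e _ _ stop) e′ x∈ with order pp₂ seg (trans e′ e)
        ... | equal refl refl _ = x∈
        ... | before m refl _   = ∈-++⁺ˡ (subst (_ ∈_) (∷ʳ-++ pp₂ z m) (∈-++⁺ˡ x∈))
        ... | after []      refl refl = ⊥-elim (stop refl lt)
        ... | after (a ∷ m) refl refl = ⊥-elim (stop refl (late (seg ∷ʳ entry) (sym (∷ʳ-++ seg entry (a ∷ m)))))
        finish : ∀ l → pp₂ ++ z ∷ rest ≡ l → Dishonest v (pp₁ ++ w ∷ pp₂) z rest
        finish [] e = ⊥-elim (++-∷-≢[] pp₂ e)
        finish (y ∷ l) e = mkDishonest refl sw t≤ d (within d refl)
          where
          lty : D y < suc (length l)
          lty = late-head pp₂ late lt e
          sw′ : Shortest w (w ∷ y ∷ l)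
          sw′ = subst (λ l → Shortest w (w ∷ l)) e sw
          t≤ : ten w ≤ ten v
          -- If `ten w` exceeded `ten v`, then `outer` and `mate-lower` would order `D w` and
          -- `D (σ w)` in opposite ways.
          t≤ = ≮⇒≥ λ t> → <-asym (outer pp₁ t<L s′ t>) (mate-lower w<L sw′ lty)
          d : Detour w (pp₂ ++ z ∷ rest)
          d = subst (Detour w) (sym e) (det t≤ refl sw′ lty)

      -- Bases of inner states of shortest paths.

      Inner : ℕ → Set
      Inner k = ∀ {v z c rest} pp → ten v < k → Shortest v (pp ++ z ∷ rest) → ten z < k → Base k z c →
                Last k rest c

      -- At a dishonest `z`, the detour of `w` shows that a shortest path to `z` passes `σ w` with
      -- only states of tenacity below `ten w` after it, so `z` and `w` share their base at `k`.
      -- Everything from `z` to `w` is below `k`, hence the base of `w` on this path lies behind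
      -- `z`.
      inner : ∀ {k} → k ≤ L → Bases k → (∀ {j} → j < k → Detours j) → Inner k
      inner {k} k≤L bases det {v} {z} {c} {rest} pp v<k s z<k B with D z <? suc (length rest)
      ... | no ≮ = base-behind z<k B (early-shortest pp s ≮)
      ... | yes lt with dishonest pp (<-≤-trans v<k k≤L) (λ j≤ → det (≤-<-trans j≤ v<k)) s lt
      ... | mkDishonest {pp₁} {pp₂} {w} refl short ten≤ detour within
        with bases w (≤-<-trans ten≤ v<k) | shortest (<-≤-trans z<k k≤L)
      ...   | c′ , B′ | lz , sz with Detour.inside detour (within (∈-++⁺ʳ pp₂ (here refl)))
      ...     | z<w , Bz with Bz (inj₁ sz)
      ...       | mkLast {post} refl h low = result
        where
        w<k : ten w < k
        w<k = ≤-<-trans ten≤ v<k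
        sσw : Shortest (σ w) (σ w ∷ _)
        sσw = honest post (<-≤-trans z<k k≤L) sz (≤-trans (<⇒≤ z<w) h)
        c≡c′ : c ≡ c′
        c≡c′ = last-unique (B (inj₁ sz)) (last-extend post (λ x∈ → <-trans (low x∈) w<k) (B′ (inj₂ sσw)))
        low′ : ∀ {x} → x ∈ w ∷ pp₂ ∷ʳ z → ten x < k
        low′ (here refl) = w<k
        low′ (there x∈)  = <-trans (proj₁ (Detour.inside detour (within x∈))) w<k
        Lw : Last k ((w ∷ pp₂ ∷ʳ z) ++ rest) c
        Lw rewrite c≡c′ | ∷ʳ-++ pp₂ z rest = B′ (inj₁ short)
        result : Last k rest c
        result = last-drop (w ∷ pp₂ ∷ʳ z) low′ Lw

      -- By `Inner`, the base of such a `z` is the last high state behind it, and this is `c`.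
      after-base : ∀ {k u c g} → k ≤ L → Bases k → Inner k → ten u < k → Shortest u g → (l : Last k g c) →
                   ∀ {z} → z ∈ Last.post l → ten z < k × Base k z c
      after-base {k} {u} {c} k≤L bases inn u<k s (mkLast {post} {rest} refl h low) {z} z∈ with ∈-∃++ z∈
      ... | a , m , refl with bases z (low z∈)
      ...   | c′ , B = low z∈ , subst (Base k z) c′≡c B
        where
        s′ : Shortest u (a ++ z ∷ m ++ c ∷ rest)
        s′ = subst (Shortest u) (++-assoc a (z ∷ m) (c ∷ rest)) s
        c′≡c : c′ ≡ c
        c′≡c = last-unique (inn a u<k s′ (low z∈) B)
                 (mkLast {post = m} refl h λ x∈ → low (∈-++⁺ʳ a (there x∈)))

      -- Construction of a detour.

      module MakeDetour {v : X} (v<L : ten v < L) (bases : Bases (ten v)) (inn : Inner (ten v))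
                  {y : X} {rest : List X} (s : Shortest v (v ∷ y ∷ rest)) (lt : D y < suc (length rest)) where

        k : ℕ
        k = ten v

        k≤L : k ≤ L
        k≤L = <⇒≤ v<L

        <L : ∀ {x} → ten x < k → ten x < L
        <L x<k = <-trans x<k v<L

        p : Path v (v ∷ y ∷ rest)
        p = proj₁ s

        y<k : ten y < k
        y<k = ≰⇒> λ h → <-irrefl (sym (proj₂ (honest (v ∷ []) v<L s h))) lt

        -- From `σ v` the flipped edge leads to `σ y`, and from there the path can be retraced to
        -- `σ b`. With the direct way to `b` this makes the tenacity of `b` smaller than that of
        -- `v`.
        no-high-between : ∀ {b r} post m → Shortest y (post ++ b ∷ m ++ σ v ∷ r) → ¬ k ≤ ten b
        no-high-between [] m (q , _) h with path-head q
        ... | refl = <⇒≱ y<k h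
        no-high-between {b} {r} (_ ∷ post) m sq@(q , eq) h with path-head q
        ... | refl = refute 9
            (λ dv dσv db dσb dy post m r i →
              (dv ⊞ dσv ≼ db ⊞ dσb) ∷ (con 2 ⊞ i ≼ dv) ∷ (con 1 ⊞ dy ≼ con 1 ⊞ i) ∷
              (con 1 ⊞ post ⊞ (con 1 ⊞ (m ⊞ (con 1 ⊞ r))) ≼ dy) ∷ (con 1 ⊞ r ≼ dσv) ∷
              (db ≼ con 1 ⊞ (m ⊞ (con 1 ⊞ r))) ∷ (dσb ≼ con 1 ⊞ post ⊞ (con 2 ⊞ r)) ∷ [])
            (D v ∷ D (σ v) ∷ D b ∷ D (σ b) ∷ D y ∷ length post ∷ length m ∷ length r ∷ length rest ∷ [])
            (h ∷ ≤-reflexive (proj₂ s) ∷ lt ∷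
             ≤-reflexive (trans (cong (λ j → suc (length post + suc j)) (sym (length-++ m)))
               (trans (cong suc (sym (length-++ post))) eq)) ∷
             ≤-reflexive (proj₂ (honest (y ∷ post ++ b ∷ m) (<L y<k) (q₂ , eq₂)
               (≤-trans (<⇒≤ y<k) (≤-reflexive (sym (ten-σ v)))))) ∷
             ≤-trans (D-suffix (y ∷ post) q) (≤-reflexive (cong suc (length-++ m))) ∷
             ≤-trans (D-⟲ (post ∷ʳ b) rv) (≤-reflexive (cong (_+ _) (length-∷ʳ post))) ∷ [])
          where
          split₂ : y ∷ post ++ b ∷ m ++ σ v ∷ r ≡ (y ∷ post ++ b ∷ m) ++ σ v ∷ r
          split₂ = sym (++-assoc (y ∷ post) (b ∷ m) (σ v ∷ r))
          q₁ : Path y (y ∷ (post ∷ʳ b) ++ (m ++ σ v ∷ r))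
          q₁ = subst (λ l → Path y (y ∷ l)) (sym (∷ʳ-++ post b _)) q
          q₂ : Path y ((y ∷ post ++ b ∷ m) ++ σ v ∷ r)
          q₂ = subst (Path y) split₂ q
          eq₂ : length ((y ∷ post ++ b ∷ m) ++ σ v ∷ r) ≡ D y
          eq₂ = trans (cong length (sym split₂)) eq
          dis : Disjoint (y ∷ post ++ b ∷ m) (σ v ∷ r)
          dis = path-disjoint (y ∷ post ++ b ∷ m) q₂
          turned : Path (σ y) (σ y ∷ σ v ∷ r)
          turned = step (path-suffix (y ∷ post ++ b ∷ m) q₂) (E-skew (path-edge p)) λ z∈ → dis (here refl) z∈
          dis′ : Disjoint (post ∷ʳ b) (σ y ∷ σ v ∷ r)
          dis′ a∈ (here refl) e = path-fresh q₁ (∈-++⁺ˡ a∈) (sym e)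
          dis′ a∈ (there b∈)  e =
            dis (there (subst (_ ∈_) (∷ʳ-++ post b m) (∈-++⁺ˡ a∈))) b∈ e
          rv : Path (σ b) ((post ∷ʳ b) ⟲ (σ y ∷ σ v ∷ r))
          rv = subst (λ x → Path (σ x) ((post ∷ʳ b) ⟲ (σ y ∷ σ v ∷ r))) (lastFrom-∷ʳ y post)
                 (retrace (post ∷ʳ b) q₁ refl turned dis′)

        base-y : Base k y (σ v)
        base-y with bases y y<k | shortest (<L y<k)
        ... | b , B | r , sr with ∈-∃++ (dishonest-mate s lt sr) | B (inj₁ sr)
        ...   | post₁ , r₁ , e | mkLast {post} refl h low with order post post₁ e
        ...     | equal _ refl _     = B
        ...     | before m refl refl = ⊥-elim (no-high-between post m sr h)
        ...     | after m refl _     = ⊥-elim (<-irrefl (ten-σ v) (low (∈-++⁺ʳ post₁ (here refl))))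

        -- The blossom of `σ v` at threshold `k`.
        Inside : X → Set
        Inside z = ten z < k × Base k z (σ v)

        inside? : ∀ z → Dec (Inside z)
        inside? z with ten z <? k
        ... | no ≮ = no λ i → ≮ (proj₁ i)
        ... | yes z<k with bases z z<k
        ...   | c , B with ≡-dec _≟_ Bool._≟_ c (σ v)
        ...     | yes refl = yes (z<k , B)
        ...     | no c≢    = no λ i → c≢ (base-unique (<L z<k) B (proj₂ i))

        inside-σ : ∀ {z} → Inside z → Inside (σ z)
        inside-σ {z} (z<k , B) = subst (_< k) (sym (ten-σ z)) z<k , base-σ B

        inside-vertex : ∀ {a z} → proj₁ a ≡ proj₁ z → Inside a → Inside z
        inside-vertex {a} {z} e i with same-vertex {z} {a} (sym e)
        ... | inj₁ refl = i
        ... | inj₂ refl = inside-σ i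

        -- As lists run backwards, the state found is the first one inside the blossom that the path
        -- visits.
        deepest : ∀ l → (∀ {z} → z ∈ l → ¬ Inside z) ⊎
                  (∃ λ P → ∃ λ x → ∃ λ Q → l ≡ P ++ x ∷ Q × Inside x × (∀ {z} → z ∈ Q → ¬ Inside z))
        deepest [] = inj₁ λ ()
        deepest (x ∷ l) with deepest l
        ... | inj₂ (P , x′ , Q , e , i , out) = inj₂ (x ∷ P , x′ , Q , cong (x ∷_) e , i , out)
        ... | inj₁ out with inside? x
        ...   | yes i = inj₂ ([] , x , l , refl , i , out)
        ...   | no ¬i = inj₁ λ { (here refl) → ¬i ; (there z∈) → out z∈ }

        module Entry {pre : List X} {x : X} {rest′ : List X} (s : Shortest v (v ∷ pre ++ x ∷ rest′))
                     (ix : Inside x) (out : ∀ {z} → z ∈ rest′ → ¬ Inside z) where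

          x<k : ten x < k
          x<k = proj₁ ix

          σx<k : ten (σ x) < k
          σx<k = proj₁ (inside-σ ix)

          back-path : ∃ λ g → ∃ λ gp → Shortest (σ x) (σ x ∷ gp ++ σ v ∷ g) ×
                      (∀ {z} → z ∈ gp → Inside z)
          back-path with shortest (<L σx<k)
          ... | l , sl with base-σ (proj₂ ix) (inj₁ sl)
          ...   | la@(mkLast {[]} refl h low) with path-head (proj₁ sl)
          ...     | e = ⊥-elim (<⇒≱ σx<k (subst (λ z → k ≤ ten z) (sym e) h))
          back-path | l , sl | la@(mkLast {a ∷ gp} {g} refl h low) with path-head (proj₁ sl)
          ... | refl = g , gp , sl , λ z∈ → after-base k≤L bases inn σx<k sl la (there z∈)

          p′ : Path v (v ∷ pre ++ x ∷ rest′)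
          p′ = proj₁ s

          ten-mate : k ≤ ten (σ v)
          ten-mate = ≤-reflexive (sym (ten-σ v))

          -- `round` reaches `v` from `x` by the other side `gp` of the blossom, so `gp` is at least
          -- as long as `pre`. Going from `σ v` back along `p` to `σ x` is therefore no longer than
          -- the given shortest path. Every other contact of `σ v ∷ g` with `p` produces a path that
          -- is too short.
          loop : ∃ λ g → Shortest (σ x) ((pre ∷ʳ x) ⟲ (σ v ∷ g))
          loop with back-path
          ... | g , gp , sg , igp = conclude (cross {pre = v ∷ pre} p′ (path-suffix (σ x ∷ gp) (proj₁ sg)))
            where
            q : Path (σ x) (σ x ∷ (gp ∷ʳ σ v) ++ g)
            q = subst (λ l → Path (σ x) (σ x ∷ l)) (sym (∷ʳ-++ gp (σ v) g)) (proj₁ sg)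
            -- `gp` lies inside the blossom, and `p` before `x` lies outside it.
            dis : Disjoint (gp ∷ʳ σ v) (x ∷ rest′)
            dis a∈ b∈ e with ∈-++⁻ gp a∈
            dis a∈ (here refl) e | inj₁ a∈gp = path-fresh q (∈-++⁺ˡ a∈) (sym e)
            dis a∈ (there b∈)  e | inj₁ a∈gp = out b∈ (inside-vertex e (igp a∈gp))
            dis a∈ b∈ e | inj₂ (here refl) = path-fresh p′ (∈-++⁺ʳ pre b∈) e
            round : Path v ((gp ∷ʳ σ v) ⟲ (x ∷ rest′))
            round = subst (λ z → Path z ((gp ∷ʳ σ v) ⟲ (x ∷ rest′)))
                      (trans (cong σ (lastFrom-∷ʳ (σ x) gp)) (σσ v))
                      (retrace (gp ∷ʳ σ v) q (sym (σσ x)) (path-suffix (v ∷ pre) p′) dis)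
            round≤ : D v ≤ suc (length gp) + suc (length rest′)
            round≤ = ≤-trans (D-⟲ (gp ∷ʳ σ v) round) (≤-reflexive (cong (_+ _) (length-∷ʳ gp)))
            len-p : suc (length pre) + suc (length rest′) ≤ D v
            len-p = ≤-reflexive (sym (length-pre (v ∷ pre) s))
            len-g : suc (length gp) + suc (length g) ≤ D (σ x)
            len-g = ≤-reflexive (sym (length-pre (σ x ∷ gp) sg))
            D-mate : suc (length g) ≤ D (σ v)
            D-mate = ≤-reflexive (proj₂ (honest (σ x ∷ gp) (<L σx<k) sg (≤-trans (<⇒≤ σx<k) ten-mate)))
            tight : ∀ C Q r′ → suc (length pre) ≡ length C → σ v ∷ g ≡ Q ++ r′ →
                    D (σ x) ≤ length C + length r′ → Q ≡ []
            tight C []      r′ _  _ _ = refl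
            tight C (a ∷ Q) r′ l₁ e h = ⊥-elim (refute 9
              (λ dv dσx pre rest g gp C Q r →
                (dv ≼ con 1 ⊞ gp ⊞ (con 1 ⊞ rest)) ∷ (con 1 ⊞ pre ⊞ (con 1 ⊞ rest) ≼ dv) ∷
                (con 1 ⊞ gp ⊞ (con 1 ⊞ g) ≼ dσx) ∷ (C ≼ con 1 ⊞ pre) ∷
                (con 1 ⊞ Q ⊞ r ≼ con 1 ⊞ g) ∷ (dσx ≼ C ⊞ r) ∷ [])
              (D v ∷ D (σ x) ∷ length pre ∷ length rest′ ∷ length g ∷ length gp ∷
               length C ∷ length Q ∷ length r′ ∷ [])
              (round≤ ∷ len-p ∷ len-g ∷ ≤-reflexive (sym l₁) ∷
               ≤-reflexive (sym (trans (cong length e) (length-++ (a ∷ Q)))) ∷ h ∷ []))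
            conclude : Disjoint (v ∷ pre ∷ʳ x) (σ v ∷ g) ⊎ Cross v (v ∷ pre) x (σ v ∷ g) →
                       ∃ λ g → Shortest (σ x) ((pre ∷ʳ x) ⟲ (σ v ∷ g))
            conclude (inj₁ none) = ⊥-elim (none (here refl) (here refl) refl)
            conclude (inj₂ (same P y′ C Q r′ _ len e new)) = ⊥-elim (refute 11
              (λ dv dσv dx pre rest g gp P C Q r →
                (dv ≼ P ⊞ (con 1 ⊞ r)) ∷ (con 1 ⊞ pre ⊞ (con 1 ⊞ rest) ≼ dv) ∷ (P ⊞ C ≼ con 1 ⊞ pre) ∷
                (Q ⊞ (con 1 ⊞ r) ≼ con 1 ⊞ g) ∷ (con 1 ⊞ g ≼ dσv) ∷ (con 1 ⊞ dσv ≼ dx) ∷ (dx ≼ con 1 ⊞ rest) ∷ [])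
              (D v ∷ D (σ v) ∷ D x ∷ length pre ∷ length rest′ ∷ length g ∷ length gp ∷
               length P ∷ length C ∷ length Q ∷ length r′ ∷ [])
              (D-++ P new ∷ len-p ∷ ≤-reflexive (sym len) ∷
               ≤-reflexive (sym (trans (cong length e) (length-++ Q))) ∷ D-mate ∷
               base-closer k≤L x<k (proj₂ ix) ∷ D-suffix (v ∷ pre) p′ ∷ []))
            conclude (inj₂ (opp (a ∷ P) y′ C Q r′ _ len e _ new)) = ⊥-elim (refute 10
              (λ dv dσx pre rest g gp P C Q r →
                (dv ≼ con 1 ⊞ gp ⊞ (con 1 ⊞ rest)) ∷ (con 1 ⊞ pre ⊞ (con 1 ⊞ rest) ≼ dv) ∷
                (con 1 ⊞ gp ⊞ (con 1 ⊞ g) ≼ dσx) ∷ (con 1 ⊞ P ⊞ C ≼ con 1 ⊞ pre) ∷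
                (Q ⊞ (con 1 ⊞ r) ≼ con 1 ⊞ g) ∷ (dσx ≼ C ⊞ (con 1 ⊞ r)) ∷ [])
              (D v ∷ D (σ x) ∷ length pre ∷ length rest′ ∷ length g ∷ length gp ∷
               length P ∷ length C ∷ length Q ∷ length r′ ∷ [])
              (round≤ ∷ len-p ∷ len-g ∷ ≤-reflexive (sym len) ∷
               ≤-reflexive (sym (trans (cong length e) (length-++ Q))) ∷ D-⟲ C new ∷ []))
            conclude (inj₂ (opp [] y′ C Q r′ e₁ len e _ new))
              with ∷-injective e₁ | tight C Q (σ y′ ∷ r′) len e (D-⟲ C new)
            ... | refl , refl | refl with proj₂ (∷-injective e)
            ...   | refl = g , new , ≤-antisym (≮⇒≥ short) (D-least new)
              where
              short : ¬ D (σ x) < length ((pre ∷ʳ x) ⟲ (σ v ∷ g))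
              short h = refute 6
                (λ dv dσx pre rest g gp →
                  (dv ≼ con 1 ⊞ gp ⊞ (con 1 ⊞ rest)) ∷ (con 1 ⊞ pre ⊞ (con 1 ⊞ rest) ≼ dv) ∷
                  (con 1 ⊞ gp ⊞ (con 1 ⊞ g) ≼ dσx) ∷ (con 1 ⊞ dσx ≼ con 1 ⊞ pre ⊞ (con 1 ⊞ g)) ∷ [])
                (D v ∷ D (σ x) ∷ length pre ∷ length rest′ ∷ length g ∷ length gp ∷ [])
                (round≤ ∷ len-p ∷ len-g ∷
                 ≤-trans h (≤-reflexive (trans (length-⟲ (pre ∷ʳ x)) (cong (_+ _) (length-∷ʳ pre)))) ∷ [])

          -- On the shortest path given by `loop` the flips of these states come after the base
          -- `σ v`, so they have that base too.
          all-inside : ∀ {z} → z ∈ pre ∷ʳ x → Inside z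
          all-inside {z} z∈ with loop
          ... | g , sl with base-σ (proj₂ ix) (inj₁ sl)
          ...   | la@(mkLast {q} e h low) with order F q (trans (sym (⟲-++ (pre ∷ʳ x))) e)
            where
            F : List X
            F = (pre ∷ʳ x) ⟲ []
          ...     | equal F≡q _ _ = inside-vertex refl
                      (after-base k≤L bases inn σx<k sl la (subst (σ z ∈_) F≡q (∈-⟲⁺ˡ {pre ∷ʳ x} z∈)))
          ...     | before _ q≡ _ = ⊥-elim (<⇒≱
                      (low (subst (σ v ∈_) (sym q≡) (∈-++⁺ʳ ((pre ∷ʳ x) ⟲ []) (here refl)))) h)
          ...     | after _ F≡ _ = ⊥-elim (path-disjoint ((pre ∷ʳ x) ⟲ [])
                      (subst (Path (σ x)) (⟲-++ (pre ∷ʳ x)) (proj₁ sl))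
                      (subst (σ v ∈_) (sym F≡) (∈-++⁺ʳ q (here refl))) (here refl) refl)

          pred<k : ∀ {a l} → rest′ ≡ a ∷ l → D a < suc (length l) → ten a < k
          pred<k {a} {l} e late = ≰⇒> λ h → <-irrefl (sym (proj₂ (honest (v ∷ pre ∷ʳ x) v<L
                    (subst (λ r → Shortest v (v ∷ r))
                      (trans (cong (λ r → pre ++ x ∷ r) e) (sym (∷ʳ-++ pre x (a ∷ l)))) s) h))) late

          -- If a were dishonest too, then retracing p from σ v to σ a and on to the base b of a would
          -- give b a tenacity below k.
          exit-honest : ∀ {a l} → rest′ ≡ a ∷ l → ¬ D a < suc (length l)
          exit-honest {a} {l} e late with bases a (pred<k e late) | shortest (<L (pred<k e late))
          ... | b , B | r , sr with B (inj₁ sr)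
          ...   | mkLast {[]} refl h low with path-head (proj₁ sr)
          ...     | refl = <⇒≱ (pred<k e late) h
          exit-honest {a} {l} e late | b , B | r , sr | la@(mkLast {_ ∷ post} {r₀} refl h low)
            with path-head (proj₁ sr)
          ... | refl = conclude (cross {pre = v ∷ pre} p′ q)
            where
            q : Path a (a ∷ post ++ b ∷ r₀)
            q = proj₁ sr
            a<k : ten a < k
            a<k = low (here refl)
            e′ : v ∷ pre ++ x ∷ rest′ ≡ (v ∷ pre ∷ʳ x) ++ a ∷ l
            e′ = cong (v ∷_) (trans (cong (λ r → pre ++ x ∷ r) e) (sym (∷ʳ-++ pre x (a ∷ l))))
            p″ : Path v ((v ∷ pre ∷ʳ x) ++ a ∷ l)
            p″ = subst (Path v) e′ p′
            b≢ : b ≢ σ v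
            b≢ refl = out (subst (a ∈_) (sym e) (here refl)) (a<k , B)
            len-p : suc (length pre) + suc (suc (length l)) ≤ D v
            len-p = ≤-trans (≤-reflexive (cong (λ r → suc (length pre) + suc (length r)) (sym e)))
                      (≤-reflexive (sym (length-pre (v ∷ pre) s)))
            len-r : suc (length post) + suc (length r₀) ≤ D a
            len-r = ≤-reflexive (sym (length-pre (a ∷ post) sr))
            conclude : Disjoint (v ∷ pre ∷ʳ x) (a ∷ post ++ b ∷ r₀) ⊎ Cross v (v ∷ pre) x (a ∷ post ++ b ∷ r₀) → ⊥
            conclude (inj₁ dis) = refute 5
              (λ dv da pre l r →
                (con 1 ⊞ pre ⊞ (con 2 ⊞ l) ≼ dv) ∷ (con 1 ⊞ da ≼ con 1 ⊞ l) ∷ (r ≼ da) ∷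
                (dv ≼ con 2 ⊞ pre ⊞ r) ∷ [])
              (D v ∷ D a ∷ length pre ∷ length l ∷ length (a ∷ post ++ b ∷ r₀) ∷ [])
              (len-p ∷ late ∷ ≤-reflexive (proj₂ sr) ∷
               ≤-trans (D-++ (v ∷ pre ∷ʳ x) (splice (v ∷ pre ∷ʳ x) p″ q dis))
                 (≤-reflexive (cong (λ n → suc n + suc (length (post ++ b ∷ r₀))) (length-∷ʳ pre))) ∷ [])
            conclude (inj₂ (same P y′ C Q r′ _ len e₁ new)) = refute 8
              (λ dv da pre l P C Q r →
                (con 1 ⊞ pre ⊞ (con 2 ⊞ l) ≼ dv) ∷ (con 1 ⊞ da ≼ con 1 ⊞ l) ∷ (Q ⊞ (con 1 ⊞ r) ≼ da) ∷
                (dv ≼ P ⊞ (con 1 ⊞ r)) ∷ (P ⊞ C ≼ con 1 ⊞ pre) ∷ [])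
              (D v ∷ D a ∷ length pre ∷ length l ∷ length P ∷ length C ∷ length Q ∷ length r′ ∷ [])
              (len-p ∷ late ∷
               ≤-trans (≤-reflexive (sym (trans (cong length e₁) (length-++ Q)))) (≤-reflexive (proj₂ sr)) ∷
               D-++ P new ∷ ≤-reflexive (sym len) ∷ [])
            -- A contact before `v` is in the blossom of `σ v`, so `σ v` would precede it on the
            -- path to `a`; but that part avoids the vertex of `v`.
            conclude (inj₂ (opp (_ ∷ P) y′ C Q r′ e₀ len e₁ clear new))
              with inn Q a<k (subst (Shortest a) e₁ sr) (proj₁ iσ) (proj₂ iσ)
              where
              iσ : Inside (σ y′)
              iσ = inside-σ (all-inside (subst (y′ ∈_) (sym (proj₂ (∷-injective e₀))) (∈-++⁺ʳ P (here refl))))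
            ... | mkLast {m} refl _ _ = clear (here refl) (∈-++⁺ʳ m (here refl)) refl
            conclude (inj₂ (opp [] y′ C Q r′ e₀ len e₁ clear new)) with ∷-injective e₀
            ... | refl , refl with order (a ∷ post) Q e₁
            ...   | equal _ b≡ _     = b≢ b≡
            ...   | after _ ap≡ _    = <-irrefl (ten-σ v) (low (subst (σ v ∈_) (sym ap≡) (∈-++⁺ʳ Q (here refl))))
            ...   | before m refl refl = refute 10
              (λ dv da dσv db dσb pre l post m r →
                (con 1 ⊞ pre ⊞ (con 2 ⊞ l) ≼ dv) ∷ (con 1 ⊞ da ≼ con 1 ⊞ l) ∷
                (con 1 ⊞ post ⊞ (con 1 ⊞ (m ⊞ (con 1 ⊞ r))) ≼ da) ∷ (con 1 ⊞ r ≼ dσv) ∷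
                (dv ⊞ dσv ≼ db ⊞ dσb) ∷ (db ≼ con 1 ⊞ (m ⊞ (con 1 ⊞ r))) ∷
                (dσb ≼ con 1 ⊞ post ⊞ (con 2 ⊞ pre ⊞ (con 1 ⊞ r))) ∷ [])
              (D v ∷ D a ∷ D (σ v) ∷ D b ∷ D (σ b) ∷ length pre ∷ length l ∷ length post ∷ length m ∷ length r′ ∷ [])
              (len-p ∷ late ∷
               ≤-trans (≤-reflexive (cong (λ n → suc (length post) + suc n) (sym (length-++ m)))) len-r ∷
               ≤-reflexive (proj₂ (honest (a ∷ post ++ b ∷ m) (<L a<k) (subst (Shortest a) e₁ sr)
                 (≤-trans (<⇒≤ a<k) ten-mate))) ∷
               h ∷ ≤-trans (D-suffix (a ∷ post) q) (≤-reflexive (cong suc (length-++ m))) ∷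
               ≤-trans (D-⟲ (post ∷ʳ b) rv) (≤-reflexive (trans (cong (_+ _) (length-∷ʳ post))
                 (cong (λ n → suc (length post) + suc n) (trans (length-⟲ (pre ∷ʳ x))
                   (cong (_+ _) (length-∷ʳ pre)))))) ∷ [])
              where
              q₁ : Path a (a ∷ (post ∷ʳ b) ++ (m ++ σ v ∷ r′))
              q₁ = subst (λ l → Path a (a ∷ l)) (sym (∷ʳ-++ post b _)) q
              dis : Disjoint (a ∷ post ++ b ∷ m) (σ v ∷ r′)
              dis = path-disjoint (a ∷ post ++ b ∷ m) (subst (Path a) e₁ q)
              fresh : ∀ {z} → z ∈ (pre ∷ʳ x) ⟲ (σ v ∷ r′) → proj₁ (σ a) ≢ proj₁ z
              fresh z∈ eq with ∈-⟲⁻ (pre ∷ʳ x) z∈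
              ... | inj₁ (c , c∈ , refl) = path-disjoint (v ∷ pre ∷ʳ x) p″ (there c∈) (here refl) (sym eq)
              ... | inj₂ z∈r = dis (here refl) z∈r eq
              turned : Path (σ a) (σ a ∷ ((pre ∷ʳ x) ⟲ (σ v ∷ r′)))
              turned = grow new (E-skew (path-edge (path-suffix (v ∷ pre)
                         (subst (λ r → Path v (v ∷ pre ++ x ∷ r)) e p′)))) fresh
              -- The blossoms of `b` and of `σ v` share no vertex, as bases are unique and
              -- `b ≢ σ v`.
              disjoint-blossoms : ∀ {y c} → y ∈ post → c ∈ pre ∷ʳ x → proj₁ y ≢ proj₁ c
              disjoint-blossoms y∈ c∈ eq =
                let (y<k , By) = after-base k≤L bases inn a<k sr la (there y∈) in
                b≢ (base-unique (<L y<k) By (proj₂ (inside-vertex (sym eq) (all-inside c∈))))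
              dis′ : Disjoint (post ∷ʳ b) (σ a ∷ ((pre ∷ʳ x) ⟲ (σ v ∷ r′)))
              dis′ y∈ (here refl) eq = path-fresh q₁ (∈-++⁺ˡ y∈) (sym eq)
              dis′ y∈ (there z∈)  eq with ∈-⟲⁻ (pre ∷ʳ x) z∈
              ... | inj₂ z∈r = dis (there (subst (_ ∈_) (∷ʳ-++ post b m) (∈-++⁺ˡ y∈))) z∈r eq
              ... | inj₁ (c , c∈ , refl) with ∈-++⁻ post y∈
              ...   | inj₁ y∈post     = disjoint-blossoms y∈post c∈ eq
              ...   | inj₂ (here refl) = <⇒≱ (proj₁ (inside-vertex (sym eq) (all-inside c∈))) h
              rv : Path (σ b) ((post ∷ʳ b) ⟲ (σ a ∷ ((pre ∷ʳ x) ⟲ (σ v ∷ r′))))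
              rv = subst (λ z → Path (σ z) ((post ∷ʳ b) ⟲ (σ a ∷ ((pre ∷ʳ x) ⟲ (σ v ∷ r′))))) (lastFrom-∷ʳ a post)
                     (retrace (post ∷ʳ b) q₁ refl turned dis′)

        detour : Detour v (y ∷ rest)
        detour with deepest (y ∷ rest)
        ... | inj₁ out = ⊥-elim (out (here refl) (y<k , base-y))
        ... | inj₂ (P , x , Q , e , ix , out) = mkDetour e all-inside (proj₂ loop) exit-honest
          where open Entry (subst (λ l → Shortest v (v ∷ l)) e s) ix out

      detours : ∀ {k} → k < L → Bases k → Inner k → Detours k
      detours k<L bases inn refl s lt = MakeDetour.detour k<L bases inn s lt

      -- From bases at threshold k to bases at threshold k + 1.

      path-no-mate : ∀ {v l} → Path v l → ¬ σ v ∈ l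
      path-no-mate {_ , false} (start _)    (here ())
      path-no-mate {_ , true}  (start _)    (here ())
      path-no-mate {_ , false} (step _ _ _) (here ())
      path-no-mate {_ , true}  (step _ _ _) (here ())
      path-no-mate (step _ _ f) (there z∈) = f z∈ refl

      suffix-< : ∀ {v y rest} P → Shortest v (P ++ y ∷ rest) → y ≢ v → D y < D v
      suffix-< [] s y≢ = ⊥-elim (y≢ (sym (path-head (proj₁ s))))
      suffix-< (a ∷ P) s y≢ = ≤-trans (s≤s (D-suffix (a ∷ P) (proj₁ s)))
        (≤-trans (s≤s (m≤n+m _ (length P))) (≤-reflexive (sym (length-pre (a ∷ P) s))))

      module NextLevel {k : ℕ} (k<L : k < L) (bases : Bases k) (inn : Inner k)
                  (det : ∀ {j} → j ≤ k → Detours j) where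

        Either : X → List X → Set
        Either c l = Shortest c l ⊎ Shortest (σ c) l

        Agree : X → Set
        Agree v = ∀ {l l′ b b′} → Either v l → Either v l′ → Last (suc k) l b → Last (suc k) l′ b′ → b ≡ b′

        -- In contrast to `inner`, `v` has tenacity exactly `k`, so the detour covering `z` may
        -- belong to a `w` of tenacity `k`; then `c` is `σ w` and `p` meets it flipped, after `z`.
        along : ∀ {v z c rest} pp → ten v ≡ k → Shortest v (pp ++ z ∷ rest) → ten z < k → Base k z c →
                Last k rest c ⊎ (ten c ≡ k × ∃ λ pp₁ → ∃ λ pp₂ → pp ≡ pp₁ ++ pp₂ ×
                                 Shortest (σ c) (pp₂ ++ z ∷ rest))
        along {v} {z} {c} {rest} pp refl s z<k B with D z <? suc (length rest)
        ... | no ≮ = inj₁ (base-behind z<k B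
                       (early-shortest pp s ≮))
        ... | yes lt with dishonest pp k<L det s lt
        ...   | mkDishonest {pp₁} {pp₂} {w} e short ten≤ detour within with m≤n⇒m<n∨m≡n ten≤
        ...     | inj₁ w<k = inj₁ (inn (w ∷ pp₂) w<k short z<k B)
        ...     | inj₂ w≡k = inj₂ (trans (cong ten c≡) (trans (ten-σ w) w≡k) , pp₁ , w ∷ pp₂ , e ,
                               subst (λ x → Shortest x (w ∷ pp₂ ++ z ∷ rest)) w≡ short)
          where
          c≡ : c ≡ σ w
          c≡ = base-unique (<-trans z<k k<L) B
                 (subst (λ j → Base j z (σ w)) w≡k (proj₂ (Detour.inside detour (within (∈-++⁺ʳ pp₂ (here refl))))))
          w≡ : w ≡ σ c
          w≡ = trans (sym (σσ w)) (cong σ (sym c≡))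

        reach : ∀ {v z c rest} pp → ten v ≡ k → Shortest v (pp ++ z ∷ rest) → ten z < k → Base k z c → ten c ≡ k →
                ∃ λ l → Either c l × ∃ λ Q → pp ++ z ∷ rest ≡ Q ++ l ×
                  (∀ {x} → x ∈ Q → x ∈ pp ⊎ ten x < suc k)
        reach {v} {z} {c} {rest} pp v≡k s z<k B c≡k with along pp v≡k s z<k B
        ... | inj₂ (_ , pp₁ , pp₂ , refl , sc) = _ , inj₂ sc , pp₁ , ++-assoc pp₁ pp₂ _ , λ x∈ → inj₁ (∈-++⁺ˡ x∈)
        ... | inj₁ (mkLast {m} {r} refl h low) = _ , inj₁ sc , pp ++ z ∷ m , e , cover
          where
          e : pp ++ z ∷ m ++ c ∷ r ≡ (pp ++ z ∷ m) ++ c ∷ r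
          e = sym (++-assoc pp (z ∷ m) (c ∷ r))
          sc : Shortest c (c ∷ r)
          sc = honest (pp ++ z ∷ m) (subst (_< L) (sym v≡k) k<L) (subst (Shortest v) e s)
                 (≤-reflexive (trans v≡k (sym c≡k)))
          cover : ∀ {x} → x ∈ pp ++ z ∷ m → x ∈ pp ⊎ ten x < suc k
          cover x∈ with ∈-++⁻ pp x∈
          ... | inj₁ x∈pp        = inj₁ x∈pp
          ... | inj₂ (here refl) = inj₂ (m<n⇒m<1+n z<k)
          ... | inj₂ (there x∈m) = inj₂ (m<n⇒m<1+n (low x∈m))

        either-path : ∀ {c l} → Either c l → ∃ λ x → Path x l
        either-path (inj₁ (p , _)) = _ , p
        either-path (inj₂ (p , _)) = _ , p

        agree-∈ : ∀ {c l l′ b} → Agree c → Either c l → Either c l′ → Last (suc k) l b → b ∈ l′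
        agree-∈ {l′ = l′} ag s s′ la with last-exists k<L (proj₂ (either-path s′))
        ... | b′ , la′@(mkLast {P} e _ _) with ag s s′ la la′
        ...   | refl = subst (_ ∈_) (sym e) (∈-++⁺ʳ P (here refl))

        -- Where r first joins p beyond b, both paths determine the same base: either directly by the
        -- induction hypothesis, or through the base c of the joining state y at the lower threshold.
        base-shared : ∀ {v p r b} → ten v ≡ k → (∀ {c} → ten c ≡ k → D c < D v → D c < D (σ v) → Agree c) →
                      Shortest v p → Shortest (σ v) r → Last (suc k) p b → b ∈ r
        base-shared {v} {_} {r} {b} v≡k IH s s′ la@(mkLast {pre} {rest} refl h low)
          with cross {pre = pre} (proj₁ s) (proj₁ s′)
        ... | inj₁ dis = ⊥-elim (dis (end-∈ pre (proj₁ s)) (path-∈ (proj₁ s′)) refl)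
        -- Turning back along `p` would reach `σ b` so early that `ten b` is at most `ten v`.
        ... | inj₂ (opp P y C Q r′ _ len refl _ new) = ⊥-elim (refute 10
              (λ dv dσv db dσb pre P C Q r i →
                (con 1 ⊞ (dv ⊞ dσv) ≼ db ⊞ dσb) ∷ (db ≼ con 1 ⊞ i) ∷ (pre ⊞ (con 1 ⊞ i) ≼ dv) ∷
                (P ⊞ C ≼ pre) ∷ (Q ⊞ (con 1 ⊞ r) ≼ dσv) ∷ (dσb ≼ C ⊞ (con 1 ⊞ r)) ∷ [])
              (D v ∷ D (σ v) ∷ D b ∷ D (σ b) ∷ length pre ∷
               length P ∷ length C ∷ length Q ∷ length r′ ∷ length rest ∷ [])
              (≤-trans (s≤s (≤-reflexive v≡k)) h ∷ D-suffix pre (proj₁ s) ∷ ≤-reflexive (sym (length-pre pre s)) ∷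
               ≤-reflexive (sym len) ∷ ≤-reflexive (sym (length-pre Q s′)) ∷ D-⟲ C new ∷ []))
        ... | inj₂ (same P y C Q r′ e _ refl _) with order pre P e
        ...   | equal _ refl _ = ∈-++⁺ʳ Q (here refl)
        ...   | before m _ e′  = ⊥-elim (++-∷-≢[] m (sym e′))
        ...   | after m refl refl = shared (m≤n⇒m<n∨m≡n (≤-pred (low (∈-++⁺ʳ P (here refl)))))
          where
          tail : List X
          tail = m ++ b ∷ rest
          v<L : ten v < L
          v<L = subst (_< L) (sym v≡k) k<L
          σv≡k : ten (σ v) ≡ k
          σv≡k = trans (ten-σ v) v≡k
          sp : Shortest v (P ++ y ∷ tail)
          sp = subst (Shortest v) (++-assoc P (y ∷ m) (b ∷ rest)) s
          lowP : ∀ {z} → z ∈ P → ten z < suc k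
          lowP z∈ = low (∈-++⁺ˡ z∈)
          lp : Last (suc k) (P ++ y ∷ tail) b
          lp = subst (λ l → Last (suc k) l b) (++-assoc P (y ∷ m) (b ∷ rest)) la
          y≢v : y ≢ v
          y≢v refl = path-no-mate (proj₁ s′) (subst (_∈ Q ++ v ∷ r′) (sym (σσ v)) (∈-++⁺ʳ Q (here refl)))
          y≢σv : y ≢ σ v
          y≢σv refl = path-no-mate (proj₁ sp) (∈-++⁺ʳ P (here refl))
          shared : ten y < k ⊎ ten y ≡ k → b ∈ Q ++ y ∷ r′
          shared (inj₂ y≡k) = ∈-++⁺ʳ Q (agree-∈ (IH y≡k (suffix-< P sp y≢v) (suffix-< Q s′ y≢σv))
            (inj₁ (honest P v<L sp (≤-reflexive (trans v≡k (sym y≡k)))))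
            (inj₁ (honest Q (subst (_< L) (sym σv≡k) k<L) s′ (≤-reflexive (trans σv≡k (sym y≡k)))))
            (last-drop P lowP lp))
          shared (inj₁ y<k) with bases y y<k
          ... | c , B with ten c ≤? k
          ...   | no c≰k with along P v≡k sp y<k B | along Q σv≡k s′ y<k B
          ...     | inj₂ (c≡k , _) | _ = ⊥-elim (c≰k (≤-reflexive c≡k))
          ...     | inj₁ _ | inj₂ (c≡k , _) = ⊥-elim (c≰k (≤-reflexive c≡k))
          ...     | inj₁ l₁ | inj₁ (mkLast {m′} refl _ _)
                    with last-unique (last-weaken (n≤1+n k) (≰⇒> c≰k) l₁)
                           (last-drop (y ∷ []) (λ { (here refl) → m<n⇒m<1+n y<k }) (last-drop P lowP lp))
          ...       | refl = ∈-++⁺ʳ Q (there (∈-++⁺ʳ m′ (here refl)))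
          shared (inj₁ y<k) | c , B | yes c≤k
            with reach P v≡k sp y<k B c≡k | reach Q σv≡k s′ y<k B c≡k
            where
            c≡k : ten c ≡ k
            c≡k with B (inj₁ (proj₂ (shortest (<-trans y<k k<L))))
            ... | mkLast _ k≤c _ = ≤-antisym c≤k k≤c
          ... | l , sl , R , e₁ , cover | l′ , sl′ , R′ , e₂ , _ =
            subst (b ∈_) (sym e₂) (∈-++⁺ʳ R′ (agree-∈
              (IH c≡k (<-≤-trans c<y (≤-trans (D-suffix P (proj₁ sp)) (suffix-≤ P sp)))
                (<-≤-trans c<y (≤-trans (D-suffix Q (proj₁ s′)) (suffix-≤ Q s′))))
              sl sl′ (last-drop R lowR (subst (λ l → Last (suc k) l b) e₁ lp))))
            where
            c<y : D c < D y
            c<y = base-closer (<⇒≤ k<L) y<k B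
            c≡k : ten c ≡ k
            c≡k with B (inj₁ (proj₂ (shortest (<-trans y<k k<L))))
            ... | mkLast _ k≤c _ = ≤-antisym c≤k k≤c
            lowR : ∀ {z} → z ∈ R → ten z < suc k
            lowR z∈ with cover z∈
            ... | inj₁ z∈P = lowP z∈P
            ... | inj₂ lt  = lt

        -- The path is honest at `b`, so a state behind `b` is nearer than `b`.
        last-furthest : ∀ {v p b b′} → ten v ≡ k → Shortest v p → Last (suc k) p b → b′ ∈ p → suc k ≤ ten b′ →
                        b′ ≡ b ⊎ D b′ < D b
        last-furthest {v} {b = b} {b′} v≡k s (mkLast {pre} {rest} refl h low) b′∈ h′ with ∈-++⁻ pre b′∈
        ... | inj₁ i           = ⊥-elim (<⇒≱ (low i) h′)
        ... | inj₂ (here refl) = inj₁ refl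
        ... | inj₂ (there i) with ∈-∃++ i
        ...   | m , r , refl with ≡-dec _≟_ Bool._≟_ b′ b
        ...     | yes e = inj₁ e
        ...     | no b′≢b = inj₂ (suffix-< (b ∷ m)
                    (honest pre (subst (_< L) (sym v≡k) k<L) s
                      (≤-trans (≤-reflexive v≡k) (≤-trans (n≤1+n k) h))) b′≢b)

        -- Each base lies on the other path by `base-shared`; if they differed, each would be nearer
        -- than the other.
        agree-mate : ∀ {v p r b b′} → ten v ≡ k → (∀ {c} → ten c ≡ k → D c < D v → D c < D (σ v) → Agree c) →
                     Shortest v p → Shortest (σ v) r → Last (suc k) p b → Last (suc k) r b′ → b ≡ b′
        agree-mate {v} {p} {r} {b} {b′} v≡k IH s s′ la la′
          with last-furthest v≡k s la b′∈p (Last.high la′) | last-furthest σv≡k s′ la′ b∈r (Last.high la)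
          where
          σv≡k : ten (σ v) ≡ k
          σv≡k = trans (ten-σ v) v≡k
          b∈r : b ∈ r
          b∈r = base-shared v≡k IH s s′ la
          b′∈p : b′ ∈ p
          b′∈p = base-shared σv≡k (λ c≡k lt lt′ → IH c≡k (subst (λ x → _ < D x) (σσ v) lt′) lt) s′
                   (subst (λ x → Shortest x p) (sym (σσ v)) s) la′
        ... | inj₁ e  | _        = sym e
        ... | inj₂ _  | inj₁ e   = e
        ... | inj₂ lt | inj₂ lt′ = ⊥-elim (<-asym lt lt′)

        -- Two shortest paths to the same state are compared through one to its mate. It suffices
        -- that `n` bounds the smaller of the two distances, because the recursion goes to states
        -- nearer than both.
        agree : ∀ n {v} → ten v ≡ k → D v < n ⊎ D (σ v) < n → Agree v
        agree zero    v≡k (inj₁ ())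
        agree zero    v≡k (inj₂ ())
        agree (suc n) {v} v≡k v<n = go
          where
          IH : ∀ {c} → ten c ≡ k → D c < D v → D c < D (σ v) → Agree c
          IH c≡k lt lt′ = agree n c≡k (inj₁
            ([ (λ h → <-≤-trans lt (≤-pred h)) , (λ h → <-≤-trans lt′ (≤-pred h)) ]′ v<n))
          v<L : ten v < L
          v<L = subst (_< L) (sym v≡k) k<L
          go : Agree v
          go (inj₁ s) (inj₂ s′) la la′ = agree-mate v≡k IH s s′ la la′
          go (inj₂ s) (inj₁ s′) la la′ = sym (agree-mate v≡k IH s′ s la′ la)
          go (inj₁ s) (inj₁ s′) la la′ with shortest-σ v<L
          ... | r , sr with last-exists k<L (proj₁ sr)
          ...   | b″ , la″ = trans (agree-mate v≡k IH s sr la la″) (sym (agree-mate v≡k IH s′ sr la′ la″))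
          go (inj₂ s) (inj₂ s′) la la′ with shortest v<L
          ... | r , sr with last-exists k<L (proj₁ sr)
          ...   | b″ , la″ = trans (sym (agree-mate v≡k IH sr s la″ la)) (agree-mate v≡k IH sr s′ la″ la′)

        bases-exact : ∀ x → ten x ≡ k → ∃ (Base (suc k) x)
        bases-exact x x≡k with shortest (subst (_< L) (sym x≡k) k<L)
        ... | l , s with last-exists k<L (proj₁ s)
        ...   | b , la = b , base
          where
          base : Base (suc k) x b
          base s′ with last-exists k<L (proj₂ (either-path s′))
          ... | b′ , la′ with agree (suc (D x)) x≡k (inj₁ ≤-refl) (inj₁ s) s′ la la′
          ...   | refl = la′

        -- The old base `c` stays valid unless `ten c` equals `k`; then the base of `c` at the new
        -- threshold takes its place.
        bases-next : Bases (suc k)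
        bases-next x (s≤s x≤k) with m≤n⇒m<n∨m≡n x≤k
        ... | inj₂ x≡k = bases-exact x x≡k
        ... | inj₁ x<k with bases x x<k
        ...   | c , B with ten c ≤? k
        ...     | no c≰k  = c , λ s → last-weaken (n≤1+n k) (≰⇒> c≰k) (B s)
        ...     | yes c≤k = b , base
          where
          c≡k : ten c ≡ k
          c≡k = ≤-antisym c≤k (Last.high (B (inj₁ (proj₂ (shortest (<-trans x<k k<L))))))
          b : X
          b = proj₁ (bases-exact c c≡k)
          base : Base (suc k) x b
          base s with B s
          base (inj₁ s) | mkLast {post} refl h low =
            last-extend post (λ z∈ → m<n⇒m<1+n (low z∈)) (proj₂ (bases-exact c c≡k)
              (inj₁ (honest post (<-trans x<k k<L) s (≤-trans x≤k h))))
          base (inj₂ s) | mkLast {post} refl h low =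
            last-extend post (λ z∈ → m<n⇒m<1+n (low z∈)) (proj₂ (bases-exact c c≡k)
              (inj₁ (honest post (subst (_< L) (sym (ten-σ x)) (<-trans x<k k<L)) s
                (≤-trans (≤-reflexive (ten-σ x)) (≤-trans x≤k h)))))

      -- The simultaneous induction, and the bases of all states on a path.

      structure : ∀ k → k ≤ L → Bases k × (∀ {j} → j < k → Detours j)
      structure zero    _   = (λ _ ()) , λ ()
      -- `inner` at `k` uses the detours below `k`, the detours at `k` use `inner` at `k`, and the
      -- next bases use the detours up to `k`.
      structure (suc k) k<L = NextLevel.bases-next k<L bases inn det′ , λ { (s≤s j≤k) → det′ j≤k }
        where
        below = structure k (<⇒≤ k<L)
        bases = proj₁ below
        inn : Inner k
        inn = inner (<⇒≤ k<L) bases (proj₂ below)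
        det′ : ∀ {j} → j ≤ k → Detours j
        det′ j≤k with m≤n⇒m<n∨m≡n j≤k
        ... | inj₁ j<k  = proj₂ below j<k
        ... | inj₂ refl = detours k<L bases inn

      -- `n` bounds `ten v`. At a dishonest `u` the recursion goes to the return path of the detour,
      -- whose end `σ entry` has smaller tenacity. Only the vertex of `c` is recovered, since that
      -- path shows part of `p` flipped.
      base-on-path : ∀ n {v u c rest} pp → ten v < n → ten v < L → ten u < L → Shortest v (pp ++ u ∷ rest) →
                     Base (suc (ten u)) u c → ∃ λ d → d ∈ pp ++ u ∷ rest × proj₁ d ≡ proj₁ c
      base-on-path (suc n) {v} {u} {c} {rest} pp v<n v<L u<L s B with D u <? suc (length rest)
      ... | no ≮ with B (inj₁ (early-shortest pp s ≮))
      ...   | mkLast {P} e _ _ = c , ∈-++⁺ʳ pp (subst (c ∈_) (sym e) (∈-++⁺ʳ P (here refl))) , refl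
      base-on-path (suc n) {v} {u} {c} {rest} pp v<n v<L u<L s B | yes lt
        with dishonest pp v<L (λ j≤ → proj₂ (structure (suc (ten v)) v<L) (s≤s j≤)) s lt
      ... | mkDishonest {pp₁} {pp₂} {w} refl short ten≤ detour within = result
        where
        open Detour detour hiding (rest) renaming (split to e-detour)
        C : List X
        C = seg ∷ʳ entry
        K : ℕ
        K = ten w
        K≤L : K ≤ L
        K≤L = <⇒≤ (≤-<-trans ten≤ v<L)
        bases = proj₁ (structure K K≤L)
        inn : Inner K
        inn = inner K≤L bases (proj₂ (structure K K≤L))
        u∈C : u ∈ C
        u∈C = within (∈-++⁺ʳ pp₂ (here refl))
        u<K : ten u < K
        u<K = proj₁ (inside u∈C)
        entry<K : ten (σ entry) < K
        entry<K = subst (_< K) (sym (ten-σ entry)) (proj₁ (inside (∈-++⁺ʳ seg (here refl))))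
        in-p : ∀ {x} → x ∈ w ∷ pp₂ ++ u ∷ rest → x ∈ (pp₁ ++ w ∷ pp₂) ++ u ∷ rest
        in-p x∈ = subst (_ ∈_) (sym (++-assoc pp₁ (w ∷ pp₂) (u ∷ rest))) (∈-++⁺ʳ pp₁ x∈)
        C⊆p : ∀ {x} → x ∈ C → x ∈ (pp₁ ++ w ∷ pp₂) ++ u ∷ rest
        C⊆p x∈ = in-p (there (subst (_ ∈_) (trans (∷ʳ-++ seg entry _) (sym e-detour)) (∈-++⁺ˡ x∈)))
        -- A state of the blossom behind `σ w` would have its base `σ w` behind itself once more, so
        -- the return path would repeat a vertex.
        not-behind : ∀ {d} → ten d < K → Base K d (σ w) → ¬ d ∈ back
        not-behind {d} d<K Bd d∈ with ∈-∃++ d∈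
        ... | b₁ , b₂ , e = path-fresh (path-suffix (C ⟲ []) (subst (Path (σ entry)) (⟲-++ C) (proj₁ return)))
                (subst (σ w ∈_) (sym e) (∈-++⁺ʳ b₁ (there
                  (subst (σ w ∈_) (sym (Last.split la)) (∈-++⁺ʳ (Last.post la) (here refl)))))) refl
          where
          la : Last K b₂ (σ w)
          la = inn ((C ⟲ []) ++ σ w ∷ b₁) entry<K
                 (subst (Shortest (σ entry)) (trans (⟲-++ C) (trans (cong (λ b → (C ⟲ []) ++ σ w ∷ b) e)
                   (sym (++-assoc (C ⟲ []) (σ w ∷ b₁) (d ∷ b₂))))) return) d<K Bd
        result : ∃ λ d → d ∈ (pp₁ ++ w ∷ pp₂) ++ u ∷ rest × proj₁ d ≡ proj₁ c
        result with shortest u<L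
        ... | lu , su with proj₂ (inside u∈C) (inj₁ su) | B (inj₁ su)
        ...   | la@(mkLast {post} refl h low) | mkLast {post′} e h′ low′ with order post post′ e
        ...     | equal _ refl _  = w , in-p (here refl) , refl
        ...     | before _ refl _ = ⊥-elim (<⇒≱ (low′ (∈-++⁺ʳ post (here refl))) (≤-trans u<K h))
        ...     | after m refl _ with after-base K≤L bases inn u<K su la (∈-++⁺ʳ post′ (here refl))
        ...       | c<K , Bc with ∈-∃++ (∈-⟲⁺ˡ {C} {σ w ∷ back} u∈C)
        ...         | S₁ , S₂ , eS
                      with base-on-path n S₁ (<-≤-trans entry<K (≤-trans ten≤ (≤-pred v<n))) (<-≤-trans entry<K K≤L)
                             (subst (_< L) (sym (ten-σ u)) u<L) (subst (Shortest (σ entry)) eS return)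
                             (subst (λ t → Base (suc t) (σ u) c) (sym (ten-σ u)) (base-σ B))
        ...           | d , d∈ , d~c with ∈-⟲⁻ C (subst (d ∈_) (sym eS) d∈)
        ...             | inj₁ (x , x∈ , refl)  = x , C⊆p x∈ , d~c
        ...             | inj₂ (here refl)      = w , in-p (here refl) , d~c
        ...             | inj₂ (there d∈back) with same-vertex {d} {c} d~c
        ...               | inj₁ refl = ⊥-elim (not-behind c<K Bc d∈back)
        ...               | inj₂ refl = ⊥-elim (not-behind (subst (_< K) (sym (ten-σ c)) c<K) (base-σ Bc) d∈back)

-- Alternating paths of the graph as paths of states.

parity : Bool → ℕ → Bool
parity α zero    = α
parity α (suc n) = parity (not α) n

parity-suc : ∀ α n → parity α (suc n) ≡ not (parity α n)
parity-suc α zero    = refl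
parity-suc α (suc n) = parity-suc (not α) n

HasParity : Bool → ℕ → Set
HasParity false n = n % 2 ≡ 0
HasParity true  n = n % 2 ≡ 1

parity⇒ : ∀ α n → HasParity α n → parity false n ≡ α
parity⇒ false zero          _ = refl
parity⇒ false (suc (suc n)) h = parity⇒ false n h
parity⇒ true  (suc zero)    _ = refl
parity⇒ true  (suc (suc n)) h = parity⇒ true n h

parity⇐ : ∀ α n → parity false n ≡ α → HasParity α n
parity⇐ false zero          _ = refl
parity⇐ true  (suc zero)    _ = refl
parity⇐ false (suc (suc n)) h = parity⇐ false n h
parity⇐ true  (suc (suc n)) h = parity⇐ true n h

last-lastFrom : ∀ {A : Set} (x : A) q → last (x ∷ q) ≡ just (lastFrom x q)
last-lastFrom x []      = refl
last-lastFrom x (y ∷ q) = last-lastFrom y q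

lastFrom-∈ : ∀ {A : Set} (x y : A) q → lastFrom x (y ∷ q) ∈ y ∷ q
lastFrom-∈ x y []      = here refl
lastFrom-∈ x y (z ∷ q) = there (lastFrom-∈ y z q)

furthest-split : ∀ {n} {G : Graph n} {Mt : Matching G} {P : V G Mt → Set} q {b} → Furthest G Mt P q b →
                 ∃ λ A → ∃ λ B → q ≡ A ++ b ∷ B × P b × (∀ {x} → x ∈ B → ¬ P x)
furthest-split {P = P} (x ∷ q) (zero , refl , Pb , later) =
  [] , q , refl , Pb , λ x∈ Px → later (suc (index x∈)) (s≤s z≤n) (subst P (lookup-index x∈) Px)
furthest-split {G = G} {Mt} (x ∷ q) (suc i , e , Pb , later)
  with furthest-split {G = G} {Mt} q (i , e , Pb , λ j i<j → later (suc j) (s≤s i<j))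
... | A , B , refl , Pb′ , none = x ∷ A , B , refl , Pb′ , none

module Bridge {n : ℕ} (G : Graph n) (Mt : Matching G) where

  open Graph G renaming (sym to Adj-sym)
  open Matching Mt
  open Skew (Fin._≟_ {n}) public

  -- `false` marks a vertex reached by an even path, `true` one reached by an odd path; unmatched
  -- edges leave the former and matched edges the latter.
  E : X → X → Set
  E (x , false) (y , true)  = Adj x y × ¬ M x y
  E (x , true)  (y , false) = M x y
  E (x , false) (y , false) = ⊥
  E (x , true)  (y , true)  = ⊥

  E-skew : ∀ {x y} → E x y → E (σ y) (σ x)
  E-skew {_ , false} {_ , true}  (e , ¬m) = Adj-sym e , λ m → ¬m (M-sym m)
  E-skew {_ , true}  {_ , false} m        = M-sym m

  E-parity : ∀ {x y} → E x y → proj₂ y ≡ not (proj₂ x)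
  E-parity {_ , false} {_ , true}  _ = refl
  E-parity {_ , true}  {_ , false} _ = refl

  Start : X → Set
  Start (x , false) = Unmatched G Mt x
  Start (x , true)  = ⊥

  open Paths E (λ {x} {y} → E-skew {x} {y}) Start public

  flag : Bool → AltFlag
  flag false = unmat
  flag true  = mat

  annotate : Bool → List (Fin n) → List X
  annotate α []      = []
  annotate α (x ∷ q) = (x , α) ∷ annotate (not α) q

  map-annotate : ∀ α q → map proj₁ (annotate α q) ≡ q
  map-annotate α []      = refl
  map-annotate α (x ∷ q) = cong (x ∷_) (map-annotate (not α) q)

  backward : List (Fin n) → List X
  backward p = annotate false p ʳ++ []

  forward : List X → List (Fin n)
  forward l = map proj₁ l ʳ++ []

  map-backward : ∀ p → map proj₁ (backward p) ≡ reverse p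
  map-backward p = trans (map-ʳ++ proj₁ (annotate false p)) (cong (_ʳ++ []) (map-annotate false p))

  length-backward : ∀ p → length (backward p) ≡ length p
  length-backward p = trans (sym (length-map proj₁ (backward p)))
    (trans (cong length (map-backward p)) (length-reverse p))

  length-forward : ∀ l → length (forward l) ≡ length l
  length-forward l = trans (length-reverse (map proj₁ l)) (length-map proj₁ l)

  ∈-backward⁺ : ∀ {u} p → u ∈ p → ∃ λ α → (u , α) ∈ backward p
  ∈-backward⁺ p u∈ with ∈-map⁻ proj₁ (subst (_ ∈_) (sym (map-backward p)) (reverse⁺ u∈))
  ... | (u , α) , i , refl = α , i

  ∈-backward⁻ : ∀ {x} p → x ∈ backward p → proj₁ x ∈ p
  ∈-backward⁻ p x∈ = reverse⁻ (subst (_ ∈_) (map-backward p) (∈-map⁺ proj₁ x∈))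

  ∈-forward⁻ : ∀ {u} l → u ∈ forward l → ∃ λ x → x ∈ l × u ≡ proj₁ x
  ∈-forward⁻ l u∈ = ∈-map⁻ proj₁ (reverse⁻ u∈)

  PathTo : Bool → Fin n → List (Fin n) → Set
  PathTo α v p = AltPathTo G Mt v p × HasParity α (len G Mt p)

  extend : ∀ α x q {acc} → Path (x , α) ((x , α) ∷ acc) → Alt G Mt (flag α) (x ∷ q) → Unique (x ∷ q) →
           (∀ {a y} → a ∈ acc → y ∈ q → proj₁ a ≢ y) →
           Path (lastFrom x q , parity α (length q)) (annotate (not α) q ʳ++ ((x , α) ∷ acc))
  extend α x [] p _ _ _ = p
  extend α x (y ∷ q) {acc} p alt (x∉ ∷ uq) dis =
    extend (not α) y q (step p (edge α alt) fresh) (rest α alt) uq dis′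
    where
    edge : ∀ α → Alt G Mt (flag α) (x ∷ y ∷ q) → E (x , α) (y , not α)
    edge false (unm e ¬m _) = e , ¬m
    edge true  (mtc m _)    = m
    rest : ∀ α → Alt G Mt (flag α) (x ∷ y ∷ q) → Alt G Mt (flag (not α)) (y ∷ q)
    rest false (unm _ _ a) = a
    rest true  (mtc _ a)   = a
    fresh : ∀ {z} → z ∈ (x , α) ∷ acc → y ≢ proj₁ z
    fresh (here refl) e = All.lookup x∉ (here refl) (sym e)
    fresh (there z∈)  e = dis z∈ (here refl) (sym e)
    dis′ : ∀ {a z} → a ∈ (x , α) ∷ acc → z ∈ q → proj₁ a ≢ z
    dis′ (here refl) z∈ = All.lookup x∉ (there z∈)
    dis′ (there a∈)  z∈ = dis a∈ (there z∈)

  to-path : ∀ {α v} p → PathTo α v p → Path (v , α) (backward p)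
  to-path {α} (s ∷ q) (((um , uq , alt) , e) , par) =
    subst (λ x → Path x (backward (s ∷ q)))
      (cong₂ _,_ (just-injective (trans (sym (last-lastFrom s q)) e)) (parity⇒ α (length q) par))
      (extend false s q (start um) alt uq λ ())

  collapse : ∀ {x l} q → Path x l → Alt G Mt (flag (proj₂ x)) (proj₁ x ∷ q) → Unique (proj₁ x ∷ q) →
             (∀ {a y} → a ∈ l → y ∈ q → proj₁ a ≢ y) →
             ∃ λ p → p ≡ map proj₁ l ʳ++ q × AltPath G Mt p × last p ≡ last (proj₁ x ∷ q)
  collapse {x , false} q (start um) alt uq _ = x ∷ q , refl , (um , uq , alt) , refl
  collapse {y} q (step {x} {l = l} p e f) alt uq dis =
    collapse (proj₁ y ∷ q) p (alt′ x y e alt) (All.tabulate x∉ ∷ uq) dis′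
    where
    alt′ : ∀ x y → E x y → Alt G Mt (flag (proj₂ y)) (proj₁ y ∷ q) →
           Alt G Mt (flag (proj₂ x)) (proj₁ x ∷ proj₁ y ∷ q)
    alt′ (_ , false) (_ , true)  (e , ¬m) a = unm e ¬m a
    alt′ (_ , true)  (_ , false) m        a = mtc m a
    x∉ : ∀ {z} → z ∈ proj₁ y ∷ q → proj₁ x ≢ z
    x∉ (here refl) e = f (here refl) (sym e)
    x∉ (there z∈)  e = dis (there (here refl)) z∈ e
    dis′ : ∀ {a z} → a ∈ x ∷ l → z ∈ proj₁ y ∷ q → proj₁ a ≢ z
    dis′ a∈ (here refl) e = f a∈ (sym e)
    dis′ a∈ (there z∈)  e = dis (there a∈) z∈ e

  path-parity : ∀ {x l} → Path x l → parity false (length l ∸ 1) ≡ proj₂ x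
  path-parity {_ , false} (start _) = refl
  path-parity (step {x} {y} {l} p e _) = trans (parity-suc false (length l))
    (trans (cong not (path-parity p)) (sym (E-parity {x} {y} e)))

  from-path : ∀ {α v l} → Path (v , α) l → PathTo α v (forward l)
  from-path {α} {v} {l} p with collapse [] p single ([] ∷ []) (λ _ ())
  ... | _ , refl , ap , e = (ap , e) ,
    parity⇐ α _ (trans (cong (λ k → parity false (k ∸ 1)) (length-forward l)) (path-parity p))

  path-nonempty : ∀ {x l} → Path x l → length l ≡ suc (length l ∸ 1)
  path-nonempty (start _)    = refl
  path-nonempty (step _ _ _) = refl

  LevelPath : Bool → Fin n → List (Fin n) → Set
  LevelPath α v p = PathTo α v p × (∀ q → PathTo α v q → len G Mt p ≤ len G Mt q)

  from-level : ∀ α {v p} → LevelPath α v p → EvenLevelPath G Mt v p ⊎ OddLevelPath G Mt v p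
  from-level false = inj₁
  from-level true  = inj₂

  to-level : ∀ {v p} → EvenLevelPath G Mt v p ⊎ OddLevelPath G Mt v p → ∃ λ α → LevelPath α v p
  to-level (inj₁ h) = false , h
  to-level (inj₂ h) = true , h

  Least : X → Set
  Least x = ∃ λ l → Path x l × (∀ l′ → Path x l′ → length l ≤ length l′)

  Oracle : Set
  Oracle = ∀ x → Least x ⊎ (∀ l → ¬ Path x l)

  -- If no path were least, descent on the length would exclude all paths.
  ¬¬least : ∀ x → ¬ ¬ (Least x ⊎ (∀ l → ¬ Path x l))
  ¬¬least x none = none (inj₂ λ l p → noPath (suc (length l)) l ≤-refl p)
    where
    noPath : ∀ m l → length l < m → ¬ Path x l
    noPath (suc m) l (s≤s l≤m) p =
      none (inj₁ (l , p , λ l′ p′ → ≮⇒≥ λ lt → noPath m l′ (<-≤-trans lt l≤m) p′))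

  -- Double negation commutes with conjunctions over the finitely many vertices.
  ¬¬oracle : ¬ ¬ Oracle
  ¬¬oracle k =
    Fin.sequence applicative (λ v → ¬¬least (v , false)) λ evens →
    Fin.sequence applicative (λ v → ¬¬least (v , true)) λ odds →
    k λ { (v , false) → evens v ; (v , true) → odds v }
    where applicative = RawMonad.rawApplicative ¬¬-Monad

  -- Levels, tenacities and bases of vertices.

  module Levelled (oracle : Oracle) {t : ℕ} (below : BelowLm G Mt t) where

    -- Tenacities of states exceed those of vertices by 2, because D counts states.
    L : ℕ
    L = 3 + t

    D : X → ℕ
    D x with oracle x
    ... | inj₁ (l , _) = length l
    ... | inj₂ _       = L

    D-least : ∀ {x l} → Path x l → D x ≤ length l
    D-least {x} {l} p with oracle x
    ... | inj₁ (_ , _ , least) = least l p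
    ... | inj₂ none            = ⊥-elim (none l p)

    D-attain : ∀ {x} → D x < L → ∃ λ l → Path x l × length l ≡ D x
    D-attain {x} lt with oracle x
    ... | inj₁ (l , p , _) = l , p , refl
    ... | inj₂ _           = ⊥-elim (<-irrefl refl lt)

    D-positive : ∀ x → 1 ≤ D x
    D-positive x with oracle x
    ... | inj₁ (l , p , _) = ≤-trans (s≤s z≤n) (≤-reflexive (sym (path-nonempty p)))
    ... | inj₂ _           = s≤s z≤n

    augmenting : ∀ {f p} → Unmatched G Mt f → PathTo true f p → AugPath G Mt p
    augmenting {f} {s ∷ y ∷ q} um ((ap@(_ , (s∉ ∷ _) , _) , e) , _) = f , (ap , e) , um , f≢s
      where
      f≢s : f ≢ s
      f≢s refl = All.lookup s∉ (subst (_∈ y ∷ q)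
                   (just-injective (trans (sym (last-lastFrom s (y ∷ q))) e)) (lastFrom-∈ s y q)) refl

    -- A path to the odd state of an unmatched vertex is augmenting, so it has at least `t + 1`
    -- edges and `t + 2` states; the even state contributes at least one more.
    start-late : ∀ {s} → Start s → L ≤ D s + D (σ s)
    start-late {f , false} um with oracle (f , true)
    ... | inj₂ _ = m≤n+m L (D (f , false))
    ... | inj₁ (l , p , _) = +-mono-≤ (D-positive (f , false))
                               (≤-trans (s≤s long) (≤-reflexive (sym (path-nonempty p))))
      where
      long : suc t ≤ length l ∸ 1
      long = ≤-trans (below (forward l) (augmenting um (from-path p)))
               (≤-reflexive (cong (_∸ 1) (length-forward l)))

    open Levels D L D-least D-attain (λ {s} → start-late {s}) public

    length-path : ∀ {α v} p → PathTo α v p → length p ≡ suc (len G Mt p)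
    length-path (_ ∷ _) _ = refl

    level-shortest : ∀ {α v p} → LevelPath α v p → Shortest (v , α) (backward p)
    level-shortest {α} {v} {p} (to , least) = pb , ≤-antisym below-D (D-least pb)
      where
      pb : Path (v , α) (backward p)
      pb = to-path p to
      below-D : length (backward p) ≤ D (v , α)
      below-D with oracle (v , α)
      ... | inj₂ none = ⊥-elim (none _ pb)
      ... | inj₁ (l , pl , _) = ≤-trans (≤-reflexive (trans (length-backward p) (length-path p to)))
        (≤-trans (s≤s (least (forward l) (from-path pl)))
          (≤-reflexive (trans (sym (length-path (forward l) (from-path pl))) (length-forward l))))

    shortest-level : ∀ {α v l} → Shortest (v , α) l → LevelPath α v (forward l)
    shortest-level {l = l} (p , eq) = from-path p , λ q to →
      ∸-monoˡ-≤ 1 (≤-trans (≤-reflexive (trans (length-forward l) eq))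
        (≤-trans (D-least (to-path q to)) (≤-reflexive (length-backward q))))

    level-D : ∀ {α v p} → LevelPath α v p → D (v , α) ≡ suc (len G Mt p)
    level-D {p = p} h@(to , _) = trans (sym (proj₂ (level-shortest h))) (trans (length-backward p) (length-path p to))

    ten-even : ∀ {v s} → Tenacity G Mt v s → ten (v , false) ≡ 2 + s
    ten-even (_ , _ , (p , hp , refl) , (q , hq , refl) , refl) =
      trans (cong₂ _+_ (level-D {false} {p = p} hp) (level-D {true} {p = q} hq)) (cong suc (+-suc _ _))

    ten-tenacity : ∀ α {v s} → Tenacity G Mt v s → ten (v , α) ≡ 2 + s
    ten-tenacity false     h = ten-even h
    ten-tenacity true  {v} h = trans (ten-σ (v , false)) (ten-even h)

    tenacity-even : ∀ {v} → ten (v , false) < L → ∃ (Tenacity G Mt v)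
    tenacity-even lt with shortest lt | shortest-σ lt
    ... | l , s | l′ , s′ =
      _ , _ , _ , (forward l , shortest-level s , refl) , (forward l′ , shortest-level s′ , refl) , refl

    tenacity : ∀ {x} → ten x < L → ∃ (Tenacity G Mt (proj₁ x))
    tenacity {v , false} lt = tenacity-even lt
    tenacity {v , true}  lt = tenacity-even (subst (_< L) (ten-σ (v , false)) lt)

    -- Vertices of tenacity above `τ` are those of states at or above the threshold, so both notions
    -- of base pick the same place on one shortest path; `order` compares the two splittings.
    base-unique-vertex : ∀ {u β τ b c} → Tenacity G Mt u τ → ten (u , β) < L →
                         (∀ p → EvenLevelPath G Mt u p ⊎ OddLevelPath G Mt u p →
                            Furthest G Mt (λ w → TenGT G Mt w τ) p b) →
                         Base (suc (ten (u , β))) (u , β) c → b ≡ proj₁ c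
    base-unique-vertex {u} {β} {τ} {b} {c} tu u<L furthest B with shortest u<L
    ... | l , s with B (inj₁ s)
    ...   | mkLast {post} {rest} el h low
            with furthest-split {G = G} {Mt} (forward l) (furthest (forward l) (from-level β (shortest-level s)))
    ...     | A , A′ , ef , b> , ¬later = conclude (order (reverse A′) (map proj₁ post) e)
      where
      e : reverse A′ ++ b ∷ reverse A ≡ map proj₁ post ++ proj₁ c ∷ map proj₁ rest
      e = trans (sym (trans (reverse-++ A (b ∷ A′))
                        (trans (cong (_++ reverse A) (unfold-reverse b A′)) (++-assoc (reverse A′) (b ∷ []) (reverse A)))))
            (trans (cong reverse (sym ef)) (trans (reverse-involutive (map proj₁ l))
              (trans (cong (map proj₁) el) (map-++ proj₁ post (c ∷ rest)))))
      c> : TenGT G Mt (proj₁ c) τ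
      c> t′ tc = ≤-pred (≤-pred (subst₂ (λ i j → suc i ≤ j) (ten-tenacity β tu) (ten-tenacity (proj₂ c) tc) h))
      post≤ : ∀ {z} → z ∈ post → ¬ TenGT G Mt (proj₁ z) τ
      post≤ {z} z∈ z> with tenacity (≤-<-trans (≤-pred (low z∈)) u<L)
      ... | t′ , tz = refute 3 (λ τ t′ tz → (con 1 ⊞ τ ≼ t′) ∷ (con 2 ⊞ t′ ≼ tz) ∷ (tz ≼ con 2 ⊞ τ) ∷ [])
              (τ ∷ t′ ∷ ten z ∷ [])
              (z> t′ tz ∷ ≤-reflexive (sym (ten-tenacity (proj₂ z) tz)) ∷
               ≤-trans (≤-pred (low z∈)) (≤-reflexive (ten-tenacity β tu)) ∷ [])
      conclude : Order (reverse A′) b (reverse A) (map proj₁ post) (proj₁ c) (map proj₁ rest) → b ≡ proj₁ c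
      conclude (equal _ b≡c _) = b≡c
      conclude (before m e′ _) with ∈-map⁻ proj₁ (subst (b ∈_) (sym e′) (∈-++⁺ʳ (reverse A′) (here refl)))
      ... | z , z∈ , refl = ⊥-elim (post≤ z∈ b>)
      conclude (after m e′ _) =
        ⊥-elim (¬later (reverse⁻ (subst (proj₁ c ∈_) (sym e′) (∈-++⁺ʳ (map proj₁ post) (here refl)))) c>)

    -- Where `p` is honest at `u`, its part up to `u` is itself a level path of `u` and contains the
    -- base. Otherwise `u` has smaller tenacity than `v` by `honest`, and `base-on-path` applies.
    base-∈ : ∀ {α v p u b} → Tenacity G Mt v t → LevelPath α v p → u ∈ p → IsBase G Mt u b → b ∈ p
    base-∈ {α} {v} {p} {u} {b} tv lp u∈ (τ , tu , _ , furthest) with ∈-backward⁺ p u∈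
    ... | β , uβ∈ with ∈-∃++ uβ∈
    ...   | pp , rest , e = decide (D (u , β) <? suc (length rest))
      where
      v<L : ten (v , α) < L
      v<L = ≤-reflexive (cong suc (ten-tenacity α tv))
      s : Shortest (v , α) (pp ++ (u , β) ∷ rest)
      s = subst (Shortest (v , α)) e (level-shortest lp)
      decide : Dec (D (u , β) < suc (length rest)) → b ∈ p
      decide (no ≮) with furthest-split {G = G} {Mt} (forward ((u , β) ∷ rest))
        (furthest _ (from-level β (shortest-level
          (early-shortest pp s ≮))))
      ... | A , A′ , ef , _ with ∈-forward⁻ ((u , β) ∷ rest) (subst (b ∈_) (sym ef) (∈-++⁺ʳ A (here refl)))
      ...   | x , x∈ , refl = ∈-backward⁻ p (subst (x ∈_) (sym e) (∈-++⁺ʳ pp x∈))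
      decide (yes lt) = on-path (proj₁ (structure (suc (ten (u , β))) u<L) (u , β) ≤-refl)
        where
        u<L : ten (u , β) < L
        u<L = <-trans (≰⇒> λ v≤u → <-irrefl (sym (proj₂ (honest pp v<L s v≤u))) lt) v<L
        on-path : ∃ (Base (suc (ten (u , β))) (u , β)) → b ∈ p
        on-path (c , B) with base-on-path (suc (ten (v , α))) pp ≤-refl v<L u<L s B
        ... | d , d∈ , d~c = subst (_∈ p) (trans d~c (sym (base-unique-vertex tu u<L furthest B)))
                               (∈-backward⁻ p (subst (d ∈_) (sym e) d∈))

  first-base : ∀ {v k b} → IterBase G Mt v k b → ∃ (IsBase G Mt v)
  first-base (base1 h)   = _ , h
  first-base (baseS h _) = first-base h

  open DecMembership (Fin._≟_ {n}) using (_∈?_)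

  -- Each iterated base found on `p` serves as the next `u` on the same `p`.
  iterated-base-∈ : ∀ {α v p b₀} → LevelPath α v p → IsBase G Mt v b₀ →
                    ∀ {u k b} → u ∈ p → IterBase G Mt u k b → b ∈ p
  iterated-base-∈ {p = p} lp (t , tv , below , _) u∈ (base1 {b = b} h) =
    decidable-stable (b ∈? p) λ ¬b∈ → ¬¬oracle λ oracle →
      ¬b∈ (Levelled.base-∈ oracle below tv lp u∈ h)
  iterated-base-∈ lp hv u∈ (baseS h h′) = iterated-base-∈ lp hv (iterated-base-∈ lp hv u∈ h) (base1 h′)

theorem5 : ∀ {n} (G : Graph n) (M : Matching G) →
    Σ (V G M) (Unmatched G M) →
    (v : V G M) → AllIterBasesDefined G M v →
    (p : List (V G M)) → EvenLevelPath G M v p ⊎ OddLevelPath G M v p →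
    ∀ u → u ∈ p → ∀ k b → IterBase G M u k b → b ∈ p
theorem5 G M _ v (_ , _ , ib , _) p lp u u∈ k b h =
  let (_ , lp′) = Bridge.to-level G M lp ; (_ , hv) = Bridge.first-base G M ib in
  Bridge.iterated-base-∈ G M lp′ hv u∈ h
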